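{- For every integer $t\ge 14$, \[\mathrm{ex}(n,\mathrm{Tr}_3(K_{2,t}))\le \frac{1}{6}\Big(t^{3/2}+55\, t\sqrt{\log t}\Big)n^{3/2}+o(n^{3/2})\] as $n\to\infty$ (with $t$ fixed), where $\log$ is the natural logarithm.
   Context: Let $F$ be a graph. A 3-uniform hypergraph $H$ contains $F$ as a trace if there is a set $S\subseteq V(H)$ and a bijection $\psi$ from $V(F)$ onto $S$, together with an injective map $\phi$ from $E(F)$ into $E(H)$, such that for every edge $ab\in E(F)$ we have $\phi(ab)\cap S=\{\psi(a),\psi(b)\}$. $\mathrm{Tr}_3(F)$ denotes the family of all 3-uniform hypergraphs that are traces of $F$ in this sense, and $\mathrm{ex}(n,\mathrm{Tr}_3(F))$ is the maximum number of edges in an $n$-vertex 3-uniform hypergraph that does not contain $F$ as a trace. $K_{2,t}$ is the complete bipartite graph with parts of sizes $2$ and $t$. -}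

module Defs where

open import Data.Nat as ℕ using (ℕ; zero; suc)
open import Data.Integer using (+_)
open import Data.Rational using (ℚ; _/_; _+_; _*_; _<_; _≤_; 0ℚ; 1ℚ)
open import Data.Fin using (Fin)
open import Data.Fin.Subset using (Subset; _∈_; ∣_∣)
open import Data.List using (List; length; lookup)
open import Data.List.Relation.Unary.All using (All)
open import Data.List.Relation.Unary.Unique.Propositional using (Unique)
open import Data.Product using (Σ; _×_; _,_)
open import Data.Sum using (_⊎_; inj₁; inj₂)
open import Function.Definitions using (Injective)
open import Function.Bundles using (_⇔_)
open import Relation.Binary.PropositionalEquality using (_≡_)
open import Relation.Nullary using (¬_)

ℕ→ℚ : ℕ → ℚ
ℕ→ℚ m = (+ m) / 1

record Hypergraph3 (n : ℕ) : Set where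
  field
    edges   : List (Subset n)
    unique  : Unique edges
    uniform : All (λ e → ∣ e ∣ ≡ 3) edges

open Hypergraph3 public

numEdges : ∀ {n} → Hypergraph3 n → ℕ
numEdges H = length (edges H)

K2tVertex : ℕ → Set
K2tVertex t = Fin 2 ⊎ Fin t

K2tEdge : ℕ → Set
K2tEdge t = Fin 2 × Fin t

-- H contains K_{2,t} as a trace: an injective ψ : V(K_{2,t}) → V(H)
-- (a bijection onto its image S) and an injective φ : E(K_{2,t}) → E(H)
-- (edges of H indexed by positions in the duplicate-free list) such that
-- φ(ab) ∩ S = {ψ a, ψ b}, i.e. for every vertex v of K_{2,t},
-- ψ v ∈ φ(ab) iff v ∈ {a , b}.
ContainsK2tTrace : ∀ {n} (t : ℕ) → Hypergraph3 n → Set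
ContainsK2tTrace {n} t H =
  Σ (K2tVertex t → Fin n) λ ψ →
  Injective _≡_ _≡_ ψ ×
  Σ (K2tEdge t → Fin (length (edges H))) λ φ →
  Injective _≡_ _≡_ φ ×
  (∀ (i : Fin 2) (j : Fin t) (v : K2tVertex t) →
     (ψ v ∈ lookup (edges H) (φ (i , j))) ⇔ (v ≡ inj₁ i ⊎ v ≡ inj₂ j))

expTerm : ℚ → ℕ → ℚ
expTerm x zero    = 1ℚ
expTerm x (suc k) = expTerm x k * x * ((+ 1) / suc k)

expPartial : ℚ → ℕ → ℚ
expPartial x zero    = 0ℚ
expPartial x (suc K) = expPartial x K + expTerm x K

-- For rational x ≥ 0: m < e^x  iff some partial sum exceeds m.
LtExp : ℕ → ℚ → Set
LtExp m x = Σ ℕ λ K → ℕ→ℚ m < expPartial x K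

{-# OPTIONS --safe #-}
module Submission where

-- Call a pair of vertices linked if its codegree is positive, light if its codegree is at most k and
-- heavy otherwise. If two vertices had t + s common heavy neighbours, a greedy hitting set of s of
-- them would meet every large link contained in this neighbourhood, and the other t would span a
-- trace of K_{2,t}. If two vertices had 5t common linked neighbours (outside their own link), choosing
-- one edge per pair gives a digraph of outdegree at most 2, and an independent set of size t in it
-- again gives a trace. Kővári–Sós–Turán counting bounds the number of heavy pairs by √(t+s) n^{3/2}
-- and of linked pairs by √(5t) n^{3/2} (ordered pairs, n large). An edge with a light pair is paid
-- for by that pair, and a heavy pair lies in fewer than t + s edges all of whose pairs are heavy, so
--   6 |E(H)| ≤ (3k √(5t) + (t+s)^{3/2}) n^{3/2}.
-- With k = s ≈ 2b√t the hitting set exists, since e^{b²} > t, and the bound follows; if b² ≥ t/25,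
-- then s = 1 and k = t + 1 suffice.

open import Defs
open import Data.Nat as ℕ using (ℕ; zero; suc; z≤n; s≤s) renaming (_≤_ to _≤ℕ_)
import Data.Nat.Properties as ℕ
import Data.Nat.Tactic.RingSolver as ℕ-Ring
open import Data.Product using (Σ; ∃; _×_; _,_; proj₁; proj₂)
open import Data.Sum using (_⊎_; inj₁; inj₂)
open import Data.Empty using (⊥; ⊥-elim)
open import Relation.Binary.PropositionalEquality
open import Relation.Nullary

-- The leading term t^{3/2} comes from the heavy pairs alone, where the hitting set costs only s
-- extra vertices. The crude factor 5 for linked pairs is harmless, since light edges contribute
-- about k√t, which is of order t√(log t) only. Counting linked pairs meets an obstacle: a common
-- neighbour of u and w that lies in the link of {u, w} may be unusable, so the codegree bound is
-- exceeded by up to the codegree of {u, w}. Summed over all pairs, this excess is the number of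
-- ordered triples spanning an edge. The split into light and heavy already bounds that number by a
-- constant times the number of linked pairs, so the excess only adds a linear term to a quadratic
-- inequality. No o(n^{3/2}) survives: excluding a codegree of N leaves at most N - 1, and this gap
-- of one absorbs every lower-order term once n is large. The irrational t^{3/2} and √(log t) are
-- replaced by arbitrary rationals a and b above them, roots occur only squared, and e^{b²} only
-- through its partial sums.

module Combinatorics where

  open import Data.Nat using (_+_; _*_; _∸_; _^_; _≤_; _<_; _≤?_)
  open import Data.Nat.Properties
  open import Data.Nat.Tactic.RingSolver using (solve-∀)
  open import Data.Fin as Fin using (Fin)
  import Data.Fin.Properties as Fin
  open import Data.Fin.Subset using (Subset; ∣_∣; _-_; inside; outside) renaming (_∈_ to _∈ₛ_)
  open import Data.Fin.Subset.Properties using (x∈p∧x≢y⇒x∈p-y; x∈p⇒∣p-x∣<∣p∣; ⊆-antisym; drop-there)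
    renaming (_∈?_ to _∈ₛ?_)
  open import Data.List using (List; []; _∷_; _++_; length; lookup; filter; map; cartesianProduct; allFin)
  open import Data.List.Properties using (length-++; length-filter; length-map; length-tabulate)
  open import Data.List.Membership.Propositional using (_∈_)
  open import Data.List.Membership.Propositional.Properties
    using (∈-filter⁺; ∈-filter⁻; ∈-lookup; ∈-cartesianProduct⁺; ∈-allFin)
  import Data.List.Membership.DecPropositional as DecMembership
  open import Data.List.Relation.Unary.Any using (here; there)
  open import Data.List.Relation.Unary.All as All using (All; []; _∷_)
  open import Data.List.Relation.Unary.AllPairs using (AllPairs; []; _∷_)
  open import Data.Vec using ([]; _∷_; here; there)
  open import Algebra.Properties.CommutativeMonoid.Sum +-0-commutativeMonoid
    using (sum; sum-syntax; sum-cong-≗; ∑-distrib-+; ∑-comm)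
  import Algebra.Properties.Semiring.Sum +-*-semiring as Semi
  open import Function using (_∘_; id)
  open import Function.Bundles using (_⇔_; mk⇔)
  open import Function.Definitions using (Injective)
  open import Level using (0ℓ)
  open import Relation.Unary using (Pred; Decidable)

  -- Indicators, finite sums and counting

  variable
    P Q R : Set

  𝟙 : Dec P → ℕ
  𝟙 (yes _) = 1
  𝟙 (no _)  = 0

  𝟙-yes : (p : Dec P) → P → 𝟙 p ≡ 1
  𝟙-yes (yes _) _ = refl
  𝟙-yes (no ¬p) p = ⊥-elim (¬p p)

  𝟙-no : (p : Dec P) → ¬ P → 𝟙 p ≡ 0
  𝟙-no (yes p) ¬p = ⊥-elim (¬p p)
  𝟙-no (no _)  _  = refl

  𝟙-≤ : (p : Dec P) (x : ℕ) → (P → 1 ≤ x) → 𝟙 p ≤ x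
  𝟙-≤ (yes p) x f = f p
  𝟙-≤ (no _)  x f = z≤n

  𝟙≤1 : (p : Dec P) → 𝟙 p ≤ 1
  𝟙≤1 p = 𝟙-≤ p 1 (λ _ → ≤-refl)

  1≤𝟙 : (p : Dec P) → P → 1 ≤ 𝟙 p
  1≤𝟙 p x = ≤-reflexive (sym (𝟙-yes p x))

  𝟙-positive : (p : Dec P) → 1 ≤ 𝟙 p → P
  𝟙-positive (yes p) _ = p

  𝟙-* : (p : Dec P) (x : ℕ) → 1 ≤ 𝟙 p * x → P
  𝟙-* (yes p) _ _ = p

  𝟙-mono : (p : Dec P) (q : Dec Q) → (P → Q) → 𝟙 p ≤ 𝟙 q
  𝟙-mono p q f = 𝟙-≤ p (𝟙 q) (1≤𝟙 q ∘ f)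

  𝟙-∪ : (p : Dec P) (q : Dec Q) (r : Dec R) → (P → Q ⊎ R) → 𝟙 p ≤ 𝟙 q + 𝟙 r
  𝟙-∪ p q r f = 𝟙-≤ p _ λ x → lemma (f x)
    where
      lemma : _ ⊎ _ → 1 ≤ 𝟙 q + 𝟙 r
      lemma (inj₁ y) = ≤-trans (1≤𝟙 q y) (m≤m+n _ _)
      lemma (inj₂ y) = ≤-trans (1≤𝟙 r y) (m≤n+m _ _)

  sum-mono-≤ : ∀ {n} {f g : Fin n → ℕ} → (∀ i → f i ≤ g i) → sum f ≤ sum g
  sum-mono-≤ {zero}  h = z≤n
  sum-mono-≤ {suc n} h = +-mono-≤ (h Fin.zero) (sum-mono-≤ (h ∘ Fin.suc))

  term≤sum : ∀ {n} (f : Fin n → ℕ) i → f i ≤ sum f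
  term≤sum f Fin.zero    = m≤m+n _ _
  term≤sum f (Fin.suc i) = ≤-trans (term≤sum (f ∘ Fin.suc) i) (m≤n+m _ _)

  sum-const : ∀ n c → ∑[ i < n ] c ≡ n * c
  sum-const zero    c = refl
  sum-const (suc n) c = cong (c +_) (sum-const n c)

  sum-≤-const : ∀ {n} {f : Fin n → ℕ} c → (∀ i → f i ≤ c) → sum f ≤ n * c
  sum-≤-const {n} c h = ≤-trans (sum-mono-≤ h) (≤-reflexive (sum-const n c))

  ∑-*ˡ : ∀ {n} c (f : Fin n → ℕ) → ∑[ i < n ] (c * f i) ≡ c * sum f
  ∑-*ˡ c f = sym (Semi.*-distribˡ-sum c f)

  ∑-*ʳ : ∀ {n} c (f : Fin n → ℕ) → ∑[ i < n ] (f i * c) ≡ sum f * c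
  ∑-*ʳ c f = sym (Semi.*-distribʳ-sum c f)

  sum-<⇒∃ : ∀ {n} (f g : Fin n → ℕ) → sum f < sum g → ∃ λ i → f i < g i
  sum-<⇒∃ {suc n} f g lt with f Fin.zero <? g Fin.zero
  ... | yes p = Fin.zero , p
  ... | no ¬p with sum-<⇒∃ (f ∘ Fin.suc) (g ∘ Fin.suc)
                   (≰⇒> λ q → <⇒≱ lt (+-mono-≤ (≮⇒≥ ¬p) q))
  ...   | i , q = Fin.suc i , q

  ∃-sum≤n*term : ∀ {n} → 1 ≤ n → (f : Fin n → ℕ) → ∃ λ i → sum f ≤ n * f i
  ∃-sum≤n*term {n} n≥1 f
    with sum-<⇒∃ (λ _ → sum f) (λ i → suc (n * f i)) (begin-strict
        ∑[ i < n ] sum f                     ≡⟨ sum-const n (sum f) ⟩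
        n * sum f                            ≡⟨ ∑-*ˡ n f ⟨
        ∑[ i < n ] (n * f i)                 <⟨ m<n+m _ n≥1 ⟩
        n + ∑[ i < n ] (n * f i)             ≡⟨ cong (_+ ∑[ i < n ] (n * f i)) (trans (sym (*-identityʳ n)) (sym (sum-const n 1))) ⟩
        ∑[ i < n ] 1 + ∑[ i < n ] (n * f i)  ≡⟨ ∑-distrib-+ (λ _ → 1) (λ i → n * f i) ⟨
        ∑[ i < n ] suc (n * f i)             ∎)
    where open ≤-Reasoning
  ... | i , s≤s p = i , p

  -- Cauchy-Schwarz against the constant 1, obtained by adding 2xy ≤ x² + y² over all ordered pairs
  -- of terms. Over the naturals that inequality is proved by writing the larger number as x + d.
  square-sum≤ : ∀ {n} (f : Fin n → ℕ) → sum f * sum f ≤ n * ∑[ i < n ] (f i * f i)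
  square-sum≤ {n} f = *-cancelˡ-≤ 2 (begin
    2 * (sum f * sum f)                                        ≡⟨ cong (2 *_) (∑-*ʳ (sum f) f) ⟨
    2 * ∑[ i < n ] (f i * sum f)                               ≡⟨ cong (2 *_) (sum-cong-≗ λ i → sym (∑-*ˡ (f i) f)) ⟩
    2 * ∑[ i < n ] ∑[ j < n ] (f i * f j)                      ≡⟨ ∑-*ˡ 2 (λ i → ∑[ j < n ] (f i * f j)) ⟨
    ∑[ i < n ] (2 * ∑[ j < n ] (f i * f j))                    ≡⟨ sum-cong-≗ (λ i → sym (∑-*ˡ 2 λ j → f i * f j)) ⟩
    ∑[ i < n ] ∑[ j < n ] (2 * (f i * f j))                    ≤⟨ sum-mono-≤ (λ i → sum-mono-≤ λ j → 2xy≤x²+y² (f i) (f j)) ⟩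
    ∑[ i < n ] ∑[ j < n ] (f i * f i + f j * f j)              ≡⟨ sum-cong-≗ (λ i → ∑-distrib-+ (λ _ → f i * f i) (λ j → f j * f j)) ⟩
    ∑[ i < n ] (∑[ j < n ] (f i * f i) + S)                    ≡⟨ ∑-distrib-+ (λ i → ∑[ j < n ] (f i * f i)) (λ _ → S) ⟩
    ∑[ i < n ] ∑[ j < n ] (f i * f i) + ∑[ i < n ] S           ≡⟨ cong₂ _+_ (trans (sum-cong-≗ λ i → sum-const n (f i * f i)) (∑-*ˡ n λ i → f i * f i)) (sum-const n S) ⟩
    n * S + n * S                                              ≡⟨ double n S ⟩
    2 * (n * S)                                                ∎)
    where
      open ≤-Reasoning
      S = ∑[ i < n ] (f i * f i)
      double : ∀ n s → n * s + n * s ≡ 2 * (n * s)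
      double = solve-∀
      expand : ∀ x d → 2 * (x * (x + d)) + d * d ≡ x * x + (x + d) * (x + d)
      expand = solve-∀
      ordered : ∀ x y → x ≤ y → 2 * (x * y) ≤ x * x + y * y
      ordered x y p = subst (λ y → 2 * (x * y) ≤ x * x + y * y) (m+[n∸m]≡n p)
        (≤-trans (m≤m+n _ _) (≤-reflexive (expand x (y ∸ x))))
      2xy≤x²+y² : ∀ x y → 2 * (x * y) ≤ x * x + y * y
      2xy≤x²+y² x y with ≤-total x y
      ... | inj₁ p = ordered x y p
      ... | inj₂ p = subst₂ _≤_ (cong (2 *_) (*-comm y x)) (+-comm (y * y) (x * x)) (ordered y x p)

  ∑-δ : ∀ {n} (j : Fin n) → ∑[ i < n ] 𝟙 (i Fin.≟ j) ≡ 1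
  ∑-δ {suc n} Fin.zero    = cong suc (trans (sum-cong-≗ {n} {y = λ _ → 0} (λ i → 𝟙-no (Fin.suc i Fin.≟ Fin.zero) λ ())) (trans (sum-const n 0) (*-zeroʳ n)))
  ∑-δ {suc n} (Fin.suc j) = trans (sum-cong-≗ {n} λ i → suc-≟ i) (∑-δ j)
    where
      suc-≟ : ∀ i → 𝟙 (Fin.suc i Fin.≟ Fin.suc j) ≡ 𝟙 (i Fin.≟ j)
      suc-≟ i with i Fin.≟ j
      ... | yes _ = refl
      ... | no _  = refl

  count : ∀ {n} {P : Pred (Fin n) 0ℓ} → Decidable P → ℕ
  count {n} P? = ∑[ i < n ] 𝟙 (P? i)

  count-mono : ∀ {n} {P Q : Pred (Fin n) 0ℓ} (P? : Decidable P) (Q? : Decidable Q) →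
               (∀ {i} → P i → Q i) → count P? ≤ count Q?
  count-mono P? Q? f = sum-mono-≤ λ i → 𝟙-mono (P? i) (Q? i) f

  count-∪ : ∀ {n} {P Q R : Pred (Fin n) 0ℓ} (P? : Decidable P) (Q? : Decidable Q) (R? : Decidable R) →
            (∀ {i} → P i → Q i ⊎ R i) → count P? ≤ count Q? + count R?
  count-∪ P? Q? R? f = ≤-trans (sum-mono-≤ λ i → 𝟙-∪ (P? i) (Q? i) (R? i) f)
    (≤-reflexive (∑-distrib-+ (λ i → 𝟙 (Q? i)) (λ i → 𝟙 (R? i))))

  count>0⇒∃ : ∀ {n} {P : Pred (Fin n) 0ℓ} (P? : Decidable P) → 1 ≤ count P? → ∃ P
  count>0⇒∃ {n} P? p with sum-<⇒∃ (λ _ → 0) (λ i → 𝟙 (P? i))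
      (subst (_< count P?) (sym (trans (sum-const n 0) (*-zeroʳ n))) p)
  ... | i , q = i , 𝟙-positive (P? i) q

  enumerate : ∀ {n} N {P : Pred (Fin n) 0ℓ} (P? : Decidable P) → N ≤ count P? →
              Σ (Fin N → Fin n) λ y → Injective _≡_ _≡_ y × (∀ j → P (y j))
  enumerate {n} zero P? _ = (λ ()) , (λ { {()} }) , λ ()
  enumerate {suc n} (suc N) P? p with P? Fin.zero
  ... | no ¬p with enumerate (suc N) (P? ∘ Fin.suc) p
  ...   | y , inj , h = Fin.suc ∘ y , inj ∘ Fin.suc-injective , h
  enumerate {suc n} (suc N) {P} P? (s≤s p) | yes p₀ with enumerate N (P? ∘ Fin.suc) p
  ... | y , inj , h = y′ , inj′ , h′
    where
      y′ : Fin (suc N) → Fin (suc n)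
      y′ Fin.zero    = Fin.zero
      y′ (Fin.suc j) = Fin.suc (y j)
      inj′ : Injective _≡_ _≡_ y′
      inj′ {Fin.zero}  {Fin.zero}  _ = refl
      inj′ {Fin.suc i} {Fin.suc j} e = cong Fin.suc (inj (Fin.suc-injective e))
      h′ : ∀ j → P (y′ j)
      h′ Fin.zero    = p₀
      h′ (Fin.suc j) = h j

  -- Greedy hitting sets

  length-filter-∷ : ∀ {A : Set} {P : Pred A 0ℓ} (P? : Decidable P) a as →
                  length (filter P? (a ∷ as)) ≡ 𝟙 (P? a) + length (filter P? as)
  length-filter-∷ P? a as with P? a
  ... | yes _ = refl
  ... | no _  = refl

  length-filter-¬ : ∀ {A : Set} {P : Pred A 0ℓ} (P? : Decidable P) as →
                    length as ≡ length (filter P? as) + length (filter (¬? ∘ P?) as)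
  length-filter-¬ P? []       = refl
  length-filter-¬ P? (a ∷ as) with P? a
  ... | yes _ = cong suc (length-filter-¬ P? as)
  ... | no _  = trans (cong suc (length-filter-¬ P? as)) (sym (+-suc _ _))

  Σ-hits : ∀ {N} {A : Set} {S : A → Fin N → Set} (S? : ∀ a c → Dec (S a c)) k as →
    All (λ a → k ≤ count (S? a)) as → length as * k ≤ ∑[ c < N ] length (filter (λ a → S? a c) as)
  Σ-hits S? k [] _ = z≤n
  Σ-hits {N} S? k (a ∷ as) (p ∷ ps) = begin
    k + length as * k                                                    ≤⟨ +-mono-≤ p (Σ-hits S? k as ps) ⟩
    count (S? a) + ∑[ c < N ] length (filter (λ a → S? a c) as)          ≡⟨ ∑-distrib-+ (λ c → 𝟙 (S? a c)) (λ c → length (filter (λ a → S? a c) as)) ⟨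
    ∑[ c < N ] (𝟙 (S? a c) + length (filter (λ a → S? a c) as))          ≡⟨ sum-cong-≗ (λ c → length-filter-∷ (λ a → S? a c) a as) ⟨
    ∑[ c < N ] length (filter (λ a → S? a c) (a ∷ as))                   ∎
    where open ≤-Reasoning

  -- Of `l` sets with at least k of N points each, the most popular point lies in h ≥ lk/N, so at
  -- most l(1 - k/N) survive. The invariant l(1 - k/N)^s < 1 thus passes to the survivors with one
  -- point fewer to spend; everything is multiplied by powers of N.
  averaging-step : ∀ N k s l h m → l ≡ h + m → l * k ≤ N * h →
                   l * (N ∸ k) ^ suc s < N ^ suc s → m * (N ∸ k) ^ s < N ^ s
  averaging-step N k s l h m l≡h+m lk≤Nh lt = *-cancelˡ-< N (m * (N ∸ k) ^ s) (N ^ s) (begin-strict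
    N * (m * (N ∸ k) ^ s)        ≡⟨ *-assoc N m _ ⟨
    N * m * (N ∸ k) ^ s          ≤⟨ *-monoˡ-≤ ((N ∸ k) ^ s) Nm≤ ⟩
    l * (N ∸ k) * (N ∸ k) ^ s    ≡⟨ *-assoc l (N ∸ k) _ ⟩
    l * (N ∸ k) ^ suc s          <⟨ lt ⟩
    N ^ suc s                    ∎)
    where
      open ≤-Reasoning
      Nm≤ : N * m ≤ l * (N ∸ k)
      Nm≤ = begin
        N * m          ≤⟨ m+n≤o⇒m≤o∸n (N * m) (begin
          N * m + l * k  ≤⟨ +-monoʳ-≤ (N * m) lk≤Nh ⟩
          N * m + N * h  ≡⟨ *-distribˡ-+ N m h ⟨
          N * (m + h)    ≡⟨ cong (N *_) (trans (+-comm m h) (sym l≡h+m)) ⟩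
          N * l          ≡⟨ *-comm N l ⟩
          l * N          ∎) ⟩
        l * N ∸ l * k  ≡⟨ *-distribˡ-∸ l N k ⟨
        l * (N ∸ k)    ∎

  n^1+s>0⇒n>0 : ∀ n s → 0 < n ^ suc s → 1 ≤ n
  n^1+s>0⇒n>0 (suc n) s _ = s≤s z≤n

  -- Greedy choice of a point in the largest number of sets not yet hit. By `averaging-step` fewer
  -- than one set, hence none, is left after s choices.
  hitting-set : ∀ {N} {A : Set} {S : A → Fin N → Set} (S? : ∀ a c → Dec (S a c)) k s (as : List A) →
    All (λ a → k ≤ count (S? a)) as → length as * (N ∸ k) ^ s < N ^ s →
    Σ (List (Fin N)) λ D → length D ≡ s × (∀ {a} → a ∈ as → ∃ λ c → c ∈ D × S a c)
  hitting-set S? k zero [] large lt = [] , refl , λ ()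
  hitting-set S? k zero (a ∷ as) large (s≤s ())
  hitting-set {N} {S = S} S? k (suc s) as large lt
    -- A most popular point requires N ≥ 1, which the strict inequality below N ^ suc s supplies.
    with ∃-sum≤n*term (n^1+s>0⇒n>0 N s (≤-trans (s≤s z≤n) lt)) (λ c → length (filter (λ a → S? a c) as))
  ... | c , most
    with hitting-set S? k s (filter (λ a → ¬? (S? a c)) as)
           (All.tabulate λ a∈ → All.lookup large (proj₁ (∈-filter⁻ (λ a → ¬? (S? a c)) a∈)))
           (averaging-step N k s (length as) _ _ (length-filter-¬ (λ a → S? a c) as)
             (≤-trans (Σ-hits S? k as large) most) lt)
  ... | D , len , hits = c ∷ D , cong suc len , hit
    where
      hit : ∀ {a} → a ∈ as → ∃ λ d → d ∈ c ∷ D × S a d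
      hit {a} a∈ with S? a c
      ... | yes p = c , here refl , p
      ... | no ¬p with hits (∈-filter⁺ (λ a → ¬? (S? a c)) a∈ ¬p)
      ...   | d , d∈ , q = d , there d∈ , q

  -- Independent sets in digraphs of outdegree at most two

  _∖_ : ∀ {n} {P Q : Pred (Fin n) 0ℓ} → Decidable P → Decidable Q → Decidable (λ i → P i × ¬ Q i)
  (P? ∖ Q?) i = P? i ×-dec ¬? (Q? i)

  count-∖ : ∀ {n} {P Q : Pred (Fin n) 0ℓ} (P? : Decidable P) (Q? : Decidable Q) →
            count P? ≤ count (P? ∖ Q?) + ∑[ i < n ] (𝟙 (P? i) * 𝟙 (Q? i))
  count-∖ P? Q? = ≤-trans (sum-mono-≤ λ i → split (P? i) (Q? i))
    (≤-reflexive (∑-distrib-+ (λ i → 𝟙 ((P? ∖ Q?) i)) (λ i → 𝟙 (P? i) * 𝟙 (Q? i))))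
    where
      split : ∀ {P Q} (p : Dec P) (q : Dec Q) → 𝟙 p ≤ 𝟙 (p ×-dec ¬? q) + 𝟙 p * 𝟙 q
      split (yes _) (yes _) = ≤-refl
      split (yes _) (no _)  = ≤-refl
      split (no _)  _       = z≤n

  count-≢ : ∀ {n} {P : Pred (Fin n) 0ℓ} (P? : Decidable P) (v : Fin n) →
            count P? ≤ count (P? ∖ (Fin._≟ v)) + 1
  count-≢ P? v = ≤-trans (count-∖ P? (Fin._≟ v)) (+-monoʳ-≤ _
    (≤-trans (sum-mono-≤ λ i → ≤-trans (*-monoˡ-≤ (𝟙 (i Fin.≟ v)) (𝟙≤1 (P? i))) (≤-reflexive (*-identityˡ _)))
             (≤-reflexive (∑-δ v))))

  inNeighbours : ∀ {n} {P : Pred (Fin n) 0ℓ} → Decidable P → (Fin n → Fin n) → Fin n → ℕ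
  inNeighbours {n} P? z v = ∑[ y < n ] (𝟙 (P? y) * 𝟙 (v Fin.≟ z y))

  Σ-inNeighbours : ∀ {n} {P : Pred (Fin n) 0ℓ} (P? : Decidable P) z → sum (inNeighbours P? z) ≡ count P?
  Σ-inNeighbours {n} P? z = trans (∑-comm {n} {n} λ v y → 𝟙 (P? y) * 𝟙 (v Fin.≟ z y))
    (sum-cong-≗ λ y → trans (∑-*ˡ (𝟙 (P? y)) (λ v → 𝟙 (v Fin.≟ z y)))
                            (trans (cong (𝟙 (P? y) *_) (∑-δ (z y))) (*-identityʳ _)))

  count-∖-inNeighbours : ∀ {n} {P Q : Pred (Fin n) 0ℓ} (P? : Decidable P) (Q? : Decidable Q) z v →
    (∀ {i} → Q i → P i) → count Q? ≤ count (Q? ∖ (λ y → v Fin.≟ z y)) + inNeighbours P? z v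
  count-∖-inNeighbours P? Q? z v f = ≤-trans (count-∖ Q? (λ y → v Fin.≟ z y))
    (+-monoʳ-≤ _ (sum-mono-≤ λ y → *-monoˡ-≤ (𝟙 (v Fin.≟ z y)) (𝟙-mono (Q? y) (P? y) f)))

  -- Every vertex of P sends two arcs, so the indegrees sum to 2|P|, which is less than 3|P|. Both
  -- sides of the comparison carry the indicator of P, so a strict inequality at v also forces v
  -- into P.
  low-indegree : ∀ {n} (z₀ z₁ : Fin n → Fin n) {P : Pred (Fin n) 0ℓ} (P? : Decidable P) →
    1 ≤ count P? → ∃ λ v → P v × inNeighbours P? z₀ v + inNeighbours P? z₁ v ≤ 2
  low-indegree {n} z₀ z₁ {P} P? nonempty = conclude (sum-<⇒∃ (λ v → 𝟙 (P? v) * (in₀ v + in₁ v)) (λ v → 𝟙 (P? v) * 3) few)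
    where
      open ≤-Reasoning
      in₀ in₁ : Fin n → ℕ
      in₀ = inNeighbours P? z₀
      in₁ = inNeighbours P? z₁
      triple : ∀ x → x + (x + x) ≡ x * 3
      triple = solve-∀
      few : ∑[ v < n ] (𝟙 (P? v) * (in₀ v + in₁ v)) < ∑[ v < n ] (𝟙 (P? v) * 3)
      few = begin-strict
        ∑[ v < n ] (𝟙 (P? v) * (in₀ v + in₁ v))  ≤⟨ sum-mono-≤ (λ v → ≤-trans (*-monoˡ-≤ (in₀ v + in₁ v) (𝟙≤1 (P? v))) (≤-reflexive (*-identityˡ _))) ⟩
        ∑[ v < n ] (in₀ v + in₁ v)               ≡⟨ ∑-distrib-+ in₀ in₁ ⟩
        sum in₀ + sum in₁                        ≡⟨ cong₂ _+_ (Σ-inNeighbours P? z₀) (Σ-inNeighbours P? z₁) ⟩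
        count P? + count P?                      <⟨ +-monoʳ-< (count P?) (m<m+n (count P?) nonempty) ⟩
        count P? + (count P? + count P?)         ≡⟨ triple (count P?) ⟩
        count P? * 3                             ≡⟨ ∑-*ʳ 3 (λ v → 𝟙 (P? v)) ⟨
        ∑[ v < n ] (𝟙 (P? v) * 3)                ∎
      conclude : (∃ λ v → 𝟙 (P? v) * (in₀ v + in₁ v) < 𝟙 (P? v) * 3) → ∃ λ v → P v × in₀ v + in₁ v ≤ 2
      conclude (v , lt) = v , 𝟙-* (P? v) 3 (≤-trans (s≤s z≤n) lt)
                            , ℕ.≤-pred (*-cancelˡ-< (𝟙 (P? v)) (in₀ v + in₁ v) 3 lt)

  Apart : ∀ {n} (z₀ z₁ : Fin n → Fin n) → Fin n → Fin n → Set
  Apart z₀ z₁ v y = y ≢ v × v ≢ z₀ y × v ≢ z₁ y × y ≢ z₀ v × y ≢ z₁ v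

  apart? : ∀ {n} (z₀ z₁ : Fin n → Fin n) v {P : Pred (Fin n) 0ℓ} → Decidable P →
           Decidable (λ y → (((((P y × y ≢ v) × v ≢ z₀ y) × v ≢ z₁ y) × y ≢ z₀ v) × y ≢ z₁ v))
  apart? z₀ z₁ v P? = ((((P? ∖ (Fin._≟ v)) ∖ (λ y → v Fin.≟ z₀ y)) ∖ (λ y → v Fin.≟ z₁ y)) ∖ (Fin._≟ z₀ v)) ∖ (Fin._≟ z₁ v)

  count-apart : ∀ {n} (z₀ z₁ : Fin n → Fin n) v {P : Pred (Fin n) 0ℓ} (P? : Decidable P) →
    inNeighbours P? z₀ v + inNeighbours P? z₁ v ≤ 2 → count P? ≤ count (apart? z₀ z₁ v P?) + 5
  count-apart z₀ z₁ v P? in≤2 = begin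
    count P?                     ≤⟨ count-≢ P? v ⟩
    count Q₁? + 1                ≤⟨ +-monoˡ-≤ 1 (count-∖-inNeighbours P? Q₁? z₀ v proj₁) ⟩
    count Q₂? + i₀ + 1           ≤⟨ +-monoˡ-≤ 1 (+-monoˡ-≤ i₀ (count-∖-inNeighbours P? Q₂? z₁ v (proj₁ ∘ proj₁))) ⟩
    count Q₃? + i₁ + i₀ + 1      ≤⟨ +-monoˡ-≤ 1 (+-monoˡ-≤ i₀ (+-monoˡ-≤ i₁ (count-≢ Q₃? (z₀ v)))) ⟩
    count Q₄? + 1 + i₁ + i₀ + 1  ≤⟨ +-monoˡ-≤ 1 (+-monoˡ-≤ i₀ (+-monoˡ-≤ i₁ (+-monoˡ-≤ 1 (count-≢ Q₄? (z₁ v))))) ⟩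
    q₅ + 1 + 1 + i₁ + i₀ + 1     ≡⟨ regroup q₅ i₀ i₁ ⟩
    q₅ + (3 + (i₀ + i₁))         ≤⟨ +-monoʳ-≤ q₅ (+-monoʳ-≤ 3 in≤2) ⟩
    q₅ + 5                       ∎
    where
      open ≤-Reasoning
      i₀ = inNeighbours P? z₀ v
      i₁ = inNeighbours P? z₁ v
      Q₁? = P? ∖ (Fin._≟ v)
      Q₂? = Q₁? ∖ (λ y → v Fin.≟ z₀ y)
      Q₃? = Q₂? ∖ (λ y → v Fin.≟ z₁ y)
      Q₄? = Q₃? ∖ (Fin._≟ z₀ v)
      q₅ = count (apart? z₀ z₁ v P?)
      regroup : ∀ q x y → q + 1 + 1 + y + x + 1 ≡ q + (3 + (x + y))
      regroup = solve-∀

  -- In the digraph with arcs y → z₀ y and y → z₁ y every nonempty vertex set contains a vertex of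
  -- indegree at most 2, so each chosen vertex costs at most 1 + 2 + 2 vertices.
  independent-set : ∀ {n} (z₀ z₁ : Fin n → Fin n) t {P : Pred (Fin n) 0ℓ} (P? : Decidable P) →
    5 * t ≤ count P? →
    Σ (List (Fin n)) λ T → length T ≡ t × All P T × AllPairs (Apart z₀ z₁) T
  independent-set z₀ z₁ zero P? _ = [] , refl , [] , []
  independent-set z₀ z₁ (suc t) P? enough
    with low-indegree z₀ z₁ P? (≤-trans (s≤s z≤n) enough)
  ... | v , Pv , in≤2
    with independent-set z₀ z₁ t (apart? z₀ z₁ v P?)
           (+-cancelʳ-≤ 5 (5 * t) _ (≤-trans (≤-reflexive (trans (+-comm (5 * t) 5) (sym (*-suc 5 t))))
                                             (≤-trans enough (count-apart z₀ z₁ v P? in≤2))))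
  ... | T , len , inQ , indep = v ∷ T , cong suc len
      , Pv ∷ All.map (λ { (((((p , _) , _) , _) , _) , _) → p }) inQ
      , All.map (λ { (((((_ , a) , b) , c) , d) , e) → a , b , c , d , e }) inQ ∷ indep

  -- Edges as ordered triples, codegrees and traces

  AllPairs-lookup : ∀ {A : Set} {R : A → A → Set} → (∀ {x y} → R x y → R y x) →
                    ∀ {xs} → AllPairs R xs → ∀ {i j} → i ≢ j → R (lookup xs i) (lookup xs j)
  AllPairs-lookup R-sym (rs ∷ _)  {Fin.zero}  {Fin.zero}  i≢j = ⊥-elim (i≢j refl)
  AllPairs-lookup R-sym (rs ∷ _)  {Fin.zero}  {Fin.suc j} i≢j = All.lookup rs (∈-lookup j)
  AllPairs-lookup R-sym (rs ∷ _)  {Fin.suc i} {Fin.zero}  i≢j = R-sym (All.lookup rs (∈-lookup i))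
  AllPairs-lookup R-sym (_ ∷ rss) {Fin.suc i} {Fin.suc j} i≢j = AllPairs-lookup R-sym rss (i≢j ∘ cong Fin.suc)

  four-elements : ∀ {n} {e : Subset n} {a b c d} → a ≢ b → a ≢ c → b ≢ c → d ≢ a → d ≢ b → d ≢ c →
                  a ∈ₛ e → b ∈ₛ e → c ∈ₛ e → d ∈ₛ e → 4 ≤ ∣ e ∣
  four-elements {e = e} {a} {b} {c} {d} a≢b a≢c b≢c d≢a d≢b d≢c a∈ b∈ c∈ d∈ =
    ≤-trans (s≤s (≤-trans (s≤s (≤-trans (s≤s (≤-trans (s≤s z≤n) (x∈p⇒∣p-x∣<∣p∣ a∈′))) (x∈p⇒∣p-x∣<∣p∣ b∈′)))
      (x∈p⇒∣p-x∣<∣p∣ c∈′))) (x∈p⇒∣p-x∣<∣p∣ d∈)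
    where
      c∈′ : c ∈ₛ e - d
      c∈′ = x∈p∧x≢y⇒x∈p-y c∈ (d≢c ∘ sym)
      b∈′ : b ∈ₛ e - d - c
      b∈′ = x∈p∧x≢y⇒x∈p-y (x∈p∧x≢y⇒x∈p-y b∈ (d≢b ∘ sym)) b≢c
      a∈′ : a ∈ₛ e - d - c - b
      a∈′ = x∈p∧x≢y⇒x∈p-y (x∈p∧x≢y⇒x∈p-y (x∈p∧x≢y⇒x∈p-y a∈ (d≢a ∘ sym)) a≢c) a≢b

  third-element : ∀ {n} {e : Subset n} {a b c d} → ∣ e ∣ ≡ 3 → a ≢ b → a ≢ c → b ≢ c →
                  a ∈ₛ e → b ∈ₛ e → c ∈ₛ e → d ∈ₛ e → d ≡ a ⊎ d ≡ b ⊎ d ≡ c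
  third-element {a = a} {b} {c} {d} ∣e∣≡3 a≢b a≢c b≢c a∈ b∈ c∈ d∈ with d Fin.≟ a | d Fin.≟ b | d Fin.≟ c
  ... | yes p | _     | _     = inj₁ p
  ... | no _  | yes p | _     = inj₂ (inj₁ p)
  ... | no _  | no _  | yes p = inj₂ (inj₂ p)
  ... | no d≢a | no d≢b | no d≢c =
    ⊥-elim (<⇒≱ (≤-refl {4}) (subst (4 ≤_) ∣e∣≡3 (four-elements a≢b a≢c b≢c d≢a d≢b d≢c a∈ b∈ c∈ d∈)))

  count-∈ : ∀ {n} (e : Subset n) → count (_∈ₛ? e) ≡ ∣ e ∣
  count-∈ []            = refl
  count-∈ (inside ∷ e)  = cong suc (trans (shift e inside) (count-∈ e))
    where
      shift : ∀ {n} (e : Subset n) s → ∑[ i < n ] 𝟙 (Fin.suc i ∈ₛ? (s ∷ e)) ≡ count (_∈ₛ? e)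
      shift e s = sum-cong-≗ λ i → ≤-antisym (𝟙-mono (Fin.suc i ∈ₛ? (s ∷ e)) (i ∈ₛ? e) drop-there)
                                             (𝟙-mono (i ∈ₛ? e) (Fin.suc i ∈ₛ? (s ∷ e)) there)
  count-∈ (outside ∷ e) = trans (sum-cong-≗ λ i → ≤-antisym (𝟙-mono (Fin.suc i ∈ₛ? (outside ∷ e)) (i ∈ₛ? e) drop-there)
                                             (𝟙-mono (i ∈ₛ? e) (Fin.suc i ∈ₛ? (outside ∷ e)) there)) (count-∈ e)

  count-unique : ∀ {n} {P : Pred (Fin n) 0ℓ} {Q : Set} (P? : Decidable P) (Q? : Dec Q) →
                 (∀ {i j} → P i → P j → i ≡ j) → (∀ {i} → P i → Q) → count P? ≤ 𝟙 Q?
  count-unique P? Q? same f with 2 ≤? count P?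
  ... | yes two = ⊥-elim (contradict (enumerate 2 P? two))
    where
      contradict : _ → ⊥
      contradict (y , inj , Py) with inj {Fin.zero} {Fin.suc Fin.zero} (same (Py Fin.zero) (Py (Fin.suc Fin.zero)))
      ... | ()
  ... | no ¬two with 1 ≤? count P?
  ...   | no ¬one = ≤-trans (ℕ.≤-pred (≰⇒> ¬one)) z≤n
  ...   | yes one = ≤-trans (ℕ.≤-pred (≰⇒> ¬two)) (1≤𝟙 Q? (f (proj₂ (count>0⇒∃ P? one))))

  module Links {n : ℕ} (H : Hypergraph3 n) where

    edgeAt : Fin (numEdges H) → Subset n
    edgeAt = lookup (edges H)

    edgeAt-injective : ∀ {p q} → edgeAt p ≡ edgeAt q → p ≡ q
    edgeAt-injective {p} {q} e with p Fin.≟ q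
    ... | yes p≡q = p≡q
    ... | no p≢q  = ⊥-elim (AllPairs-lookup (λ x≢y → x≢y ∘ sym) (unique H) p≢q e)

    edgeAt-size : ∀ p → ∣ edgeAt p ∣ ≡ 3
    edgeAt-size p = All.lookup (uniform H) (∈-lookup p)

    Distinct : Fin n → Fin n → Fin n → Set
    Distinct u v w = u ≢ v × u ≢ w × v ≢ w

    Triple : Fin (numEdges H) → Fin n → Fin n → Fin n → Set
    Triple p u v w = Distinct u v w × u ∈ₛ edgeAt p × v ∈ₛ edgeAt p × w ∈ₛ edgeAt p

    triple? : ∀ p u v w → Dec (Triple p u v w)
    triple? p u v w = (¬? (u Fin.≟ v) ×-dec ¬? (u Fin.≟ w) ×-dec ¬? (v Fin.≟ w))
      ×-dec (u ∈ₛ? edgeAt p) ×-dec (v ∈ₛ? edgeAt p) ×-dec (w ∈ₛ? edgeAt p)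

    Edge : Fin n → Fin n → Fin n → Set
    Edge u v w = ∃ λ p → Triple p u v w

    edge? : ∀ u v w → Dec (Edge u v w)
    edge? u v w = Fin.any? λ p → triple? p u v w

    edge-swap₂₃ : ∀ {u v w} → Edge u v w → Edge u w v
    edge-swap₂₃ (p , (a , b , c) , u∈ , v∈ , w∈) = p , (b , a , c ∘ sym) , u∈ , w∈ , v∈

    edge-swap₁₂ : ∀ {u v w} → Edge u v w → Edge v u w
    edge-swap₁₂ (p , (a , b , c) , u∈ , v∈ , w∈) = p , (a ∘ sym , c , b) , v∈ , u∈ , w∈

    triple-unique : ∀ {p q u v w} → Triple p u v w → Triple q u v w → p ≡ q
    triple-unique {p} {q} s t = edgeAt-injective (⊆-antisym (⊆ s t) (⊆ t s))
      where
        ⊆ : ∀ {p q u v w} → Triple p u v w → Triple q u v w → ∀ {x} → x ∈ₛ edgeAt p → x ∈ₛ edgeAt q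
        ⊆ {p} ((a , b , c) , u∈ , v∈ , w∈) (_ , u∈′ , v∈′ , w∈′) x∈
          with third-element (edgeAt-size p) a b c u∈ v∈ w∈ x∈
        ... | inj₁ refl        = u∈′
        ... | inj₂ (inj₁ refl) = v∈′
        ... | inj₂ (inj₂ refl) = w∈′

    codegree : Fin n → Fin n → ℕ
    codegree u v = count (edge? u v)

    triples : ℕ
    triples = ∑[ u < n ] ∑[ v < n ] codegree u v

    6≤Σ-triple : ∀ p → 6 ≤ ∑[ u < n ] ∑[ v < n ] count (triple? p u v)
    6≤Σ-triple p = begin
      6                                                ≡⟨ cong (_* 2) (trans (count-∈ e) (edgeAt-size p)) ⟨
      count (_∈ₛ? e) * 2                               ≡⟨ ∑-*ʳ 2 (λ u → 𝟙 (u ∈ₛ? e)) ⟨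
      ∑[ u < n ] (𝟙 (u ∈ₛ? e) * 2)                     ≤⟨ sum-mono-≤ (λ u → scaled (u ∈ₛ? e) (second u)) ⟩
      ∑[ u < n ] ∑[ v < n ] count (triple? p u v)      ∎
      where
        open ≤-Reasoning
        e = edgeAt p
        scaled : ∀ {P : Set} {c x} (P? : Dec P) → (P → c ≤ x) → 𝟙 P? * c ≤ x
        scaled {c = c} (yes p) f = ≤-trans (≤-reflexive (*-identityˡ c)) (f p)
        scaled (no _) _ = z≤n
        third : ∀ u v → u ∈ₛ e → v ∈ₛ e × v ≢ u → 1 ≤ count (triple? p u v)
        third u v u∈ (v∈ , v≢u) = +-cancelʳ-≤ 2 1 (count (triple? p u v)) (begin
          3                                                                ≡⟨ trans (count-∈ e) (edgeAt-size p) ⟨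
          count (_∈ₛ? e)                                                   ≤⟨ count-≢ (_∈ₛ? e) u ⟩
          count ((_∈ₛ? e) ∖ (Fin._≟ u)) + 1                                ≤⟨ +-monoˡ-≤ 1 (count-≢ ((_∈ₛ? e) ∖ (Fin._≟ u)) v) ⟩
          count (((_∈ₛ? e) ∖ (Fin._≟ u)) ∖ (Fin._≟ v)) + 1 + 1             ≤⟨ +-monoˡ-≤ 1 (+-monoˡ-≤ 1 (count-mono (((_∈ₛ? e) ∖ (Fin._≟ u)) ∖ (Fin._≟ v)) (triple? p u v)
            (λ { ((w∈ , w≢u) , w≢v) → (v≢u ∘ sym , w≢u ∘ sym , w≢v ∘ sym) , u∈ , v∈ , w∈ }))) ⟩
          count (triple? p u v) + 1 + 1                                    ≡⟨ +-assoc (count (triple? p u v)) 1 1 ⟩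
          count (triple? p u v) + 2                                        ∎)
        second : ∀ u → u ∈ₛ e → 2 ≤ ∑[ v < n ] count (triple? p u v)
        second u u∈ = +-cancelʳ-≤ 1 2 _ (begin
          3                                              ≡⟨ trans (count-∈ e) (edgeAt-size p) ⟨
          count (_∈ₛ? e)                                 ≤⟨ count-≢ (_∈ₛ? e) u ⟩
          count ((_∈ₛ? e) ∖ (Fin._≟ u)) + 1              ≤⟨ +-monoˡ-≤ 1 (sum-mono-≤ λ v → 𝟙-≤ (((_∈ₛ? e) ∖ (Fin._≟ u)) v) (count (triple? p u v)) (third u v u∈)) ⟩
          ∑[ v < n ] count (triple? p u v) + 1           ∎)

    -- Each edge yields 3 · 2 · 1 ordered triples. Three distinct vertices determine the edge, and
    -- the list has no repetitions, so no triple is counted at two positions.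
    6*edges≤triples : 6 * numEdges H ≤ triples
    6*edges≤triples = begin
      6 * numEdges H                                                   ≡⟨ *-comm 6 (numEdges H) ⟩
      numEdges H * 6                                                   ≡⟨ sum-const (numEdges H) 6 ⟨
      ∑[ p < numEdges H ] 6                                            ≤⟨ sum-mono-≤ 6≤Σ-triple ⟩
      ∑[ p < numEdges H ] ∑[ u < n ] ∑[ v < n ] ∑[ w < n ] τ p u v w   ≡⟨ ∑-comm (λ p u → ∑[ v < n ] ∑[ w < n ] τ p u v w) ⟩
      ∑[ u < n ] ∑[ p < numEdges H ] ∑[ v < n ] ∑[ w < n ] τ p u v w   ≡⟨ sum-cong-≗ (λ u → ∑-comm (λ p v → ∑[ w < n ] τ p u v w)) ⟩
      ∑[ u < n ] ∑[ v < n ] ∑[ p < numEdges H ] ∑[ w < n ] τ p u v w   ≡⟨ sum-cong-≗ (λ u → sum-cong-≗ λ v → ∑-comm (λ p w → τ p u v w)) ⟩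
      ∑[ u < n ] ∑[ v < n ] ∑[ w < n ] ∑[ p < numEdges H ] τ p u v w   ≤⟨ sum-mono-≤ (λ u → sum-mono-≤ λ v → sum-mono-≤ λ w →
          count-unique (λ p → triple? p u v w) (edge? u v w) triple-unique (λ {p} x → p , x)) ⟩
      triples                                                          ∎
      where
        open ≤-Reasoning
        τ : Fin (numEdges H) → Fin n → Fin n → Fin n → ℕ
        τ p u v w = 𝟙 (triple? p u v w)

    -- A trace described by the third vertices `z i j` of its edges. Since an edge has only three
    -- vertices, it meets S in exactly {x i, y j} as soon as `z i j` avoids S; different edges may
    -- share their third vertex.
    record Configuration (t : ℕ) : Set where
      field
        x      : Fin 2 → Fin n
        y      : Fin t → Fin n
        z      : Fin 2 → Fin t → Fin n
        x-inj  : Injective _≡_ _≡_ x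
        y-inj  : Injective _≡_ _≡_ y
        edge   : ∀ i j → Edge (x i) (y j) (z i j)
        x≢y    : ∀ i j → x i ≢ y j
        z≢x    : ∀ i j i′ → z i j ≢ x i′
        z≢y    : ∀ i j j′ → z i j ≢ y j′

    configuration⇒trace : ∀ {t} → Configuration t → ContainsK2tTrace t H
    configuration⇒trace {t} C = ψ , ψ-inj , φ , φ-inj , exact
      where
        open Configuration C
        ψ : K2tVertex t → Fin n
        ψ (inj₁ i) = x i
        ψ (inj₂ j) = y j
        ψ-inj : Injective _≡_ _≡_ ψ
        ψ-inj {inj₁ i} {inj₁ i′} e = cong inj₁ (x-inj e)
        ψ-inj {inj₁ i} {inj₂ j}  e = ⊥-elim (x≢y i j e)
        ψ-inj {inj₂ j} {inj₁ i}  e = ⊥-elim (x≢y i j (sym e))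
        ψ-inj {inj₂ j} {inj₂ j′} e = cong inj₂ (y-inj e)
        φ : K2tEdge t → Fin (numEdges H)
        φ (i , j) = proj₁ (edge i j)
        z≢ψ : ∀ i j v → ψ v ≢ z i j
        z≢ψ i j (inj₁ i′) e = z≢x i j i′ (sym e)
        z≢ψ i j (inj₂ j′) e = z≢y i j j′ (sym e)
        to : ∀ i j v → ψ v ∈ₛ edgeAt (φ (i , j)) → v ≡ inj₁ i ⊎ v ≡ inj₂ j
        to i j v v∈ with edge i j
        ... | p , (a , b , c) , x∈ , y∈ , z∈ with third-element (edgeAt-size p) a b c x∈ y∈ z∈ v∈
        ...   | inj₁ e        = inj₁ (ψ-inj {v} {inj₁ i} e)
        ...   | inj₂ (inj₁ e) = inj₂ (ψ-inj {v} {inj₂ j} e)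
        ...   | inj₂ (inj₂ e) = ⊥-elim (z≢ψ i j v e)
        from : ∀ i j v → v ≡ inj₁ i ⊎ v ≡ inj₂ j → ψ v ∈ₛ edgeAt (φ (i , j))
        from i j _ (inj₁ refl) = proj₁ (proj₂ (proj₂ (edge i j)))
        from i j _ (inj₂ refl) = proj₁ (proj₂ (proj₂ (proj₂ (edge i j))))
        exact : ∀ i j v → (ψ v ∈ₛ edgeAt (φ (i , j))) ⇔ (v ≡ inj₁ i ⊎ v ≡ inj₂ j)
        exact i j v = mk⇔ (to i j v) (from i j v)
        -- An edge determines its intersection with S, and that intersection contains one `x i` and
        -- one `y j`; so equal edges have equal indices.
        φ-inj : Injective _≡_ _≡_ φ
        φ-inj {i , j} {i′ , j′} e = cong₂ _,_ i≡i′ j≡j′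
          where
            i≡i′ : i ≡ i′
            i≡i′ with to i′ j′ (inj₁ i) (subst (λ p → x i ∈ₛ edgeAt p) e (from i j (inj₁ i) (inj₁ refl)))
            ... | inj₁ refl = refl
            j≡j′ : j ≡ j′
            j≡j′ with to i′ j′ (inj₂ j) (subst (λ p → y j ∈ₛ edgeAt p) e (from i j (inj₂ j) (inj₂ refl)))
            ... | inj₂ refl = refl

  -- Finding traces among common neighbours

  _∈ₗ?_ : ∀ {n} (i : Fin n) (D : List (Fin n)) → Dec (i ∈ D)
  _∈ₗ?_ = DecMembership._∈?_ Fin._≟_

  count-∈ₗ : ∀ {n} (D : List (Fin n)) → count (_∈ₗ? D) ≤ length D
  count-∈ₗ {n} [] = ≤-trans (sum-≤-const {n} {λ i → 𝟙 (i ∈ₗ? [])} 0 λ i → ≤-reflexive (𝟙-no (i ∈ₗ? []) λ ()))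
                            (≤-reflexive (*-zeroʳ n))
  count-∈ₗ {n} (c ∷ D) = ≤-trans
    (count-∪ (_∈ₗ? (c ∷ D)) (Fin._≟ c) (_∈ₗ? D) (λ { (here e) → inj₁ e ; (there i∈) → inj₂ i∈ }))
    (+-mono-≤ (≤-reflexive (∑-δ c)) (count-∈ₗ D))

  count-∁ : ∀ {n} {P : Pred (Fin n) 0ℓ} (P? : Decidable P) → n ≤ count (λ i → ¬? (P? i)) + count P?
  count-∁ {n} P? = ≤-trans (≤-reflexive (sym (trans (sum-const n 1) (*-identityʳ n))))
    (≤-trans (sum-mono-≤ λ i → cover (P? i)) (≤-reflexive (∑-distrib-+ (λ i → 𝟙 (¬? (P? i))) (λ i → 𝟙 (P? i)))))
    where
      cover : ∀ {P} (p : Dec P) → 1 ≤ 𝟙 (¬? p) + 𝟙 p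
      cover (yes _) = ≤-refl
      cover (no _)  = ≤-refl

  count-image : ∀ {n N} (y : Fin N → Fin n) {P : Pred (Fin n) 0ℓ} (P? : Decidable P) →
                count (λ w → P? w ×-dec Fin.any? (λ c → w Fin.≟ y c)) ≤ count (λ c → P? (y c))
  count-image {n} {N} y {P} P? = begin
    count (λ w → P? w ×-dec Fin.any? (λ c → w Fin.≟ y c))          ≤⟨ sum-mono-≤ (λ w → 𝟙-≤ (P? w ×-dec Fin.any? (λ c → w Fin.≟ y c)) (∑[ c < N ] (𝟙 (P? (y c)) * 𝟙 (w Fin.≟ y c))) (witness w)) ⟩
    ∑[ w < n ] ∑[ c < N ] (𝟙 (P? (y c)) * 𝟙 (w Fin.≟ y c))         ≡⟨ ∑-comm {n} {N} (λ w c → 𝟙 (P? (y c)) * 𝟙 (w Fin.≟ y c)) ⟩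
    ∑[ c < N ] ∑[ w < n ] (𝟙 (P? (y c)) * 𝟙 (w Fin.≟ y c))         ≡⟨ sum-cong-≗ (λ c → trans (∑-*ˡ (𝟙 (P? (y c))) (λ w → 𝟙 (w Fin.≟ y c)))
                                                                         (trans (cong (𝟙 (P? (y c)) *_) (∑-δ (y c))) (*-identityʳ _))) ⟩
    count (λ c → P? (y c))                                         ∎
    where
      open ≤-Reasoning
      witness : ∀ w → P w × ∃ (λ c → w ≡ y c) → 1 ≤ ∑[ c < N ] (𝟙 (P? (y c)) * 𝟙 (w Fin.≟ y c))
      witness w (Pw , c , refl) = ≤-trans
        (≤-reflexive (sym (cong₂ _*_ (𝟙-yes (P? (y c)) Pw) (𝟙-yes (y c Fin.≟ y c) refl))))
        (term≤sum (λ c → 𝟙 (P? (y c)) * 𝟙 (w Fin.≟ y c)) c)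

  pairs : ∀ N → List (Fin 2 × Fin N)
  pairs N = cartesianProduct (allFin 2) (allFin N)

  length-pairs : ∀ N → length (pairs N) ≡ 2 * N
  length-pairs N = trans (length-++ (row Fin.zero) {row (Fin.suc Fin.zero) ++ []})
    (cong₂ _+_ (length-row Fin.zero) (trans (length-++ (row (Fin.suc Fin.zero)) {[]})
                                            (cong (_+ 0) (length-row (Fin.suc Fin.zero)))))
    where
      row : Fin 2 → List (Fin 2 × Fin N)
      row i = map (i ,_) (allFin N)
      length-row : ∀ i → length (row i) ≡ N
      length-row i = trans (length-map (i ,_) (allFin N)) (length-tabulate {n = N} id)

  -- τ enumerates what is left after deleting a hitting set of the sets with at least k elements.
  select-unhit : ∀ t s k {A : Set} {S : A → Fin (t + s) → Set} (S? : ∀ a c → Dec (S a c)) (as : List A) →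
    length as * (t + s ∸ k) ^ s < (t + s) ^ s →
    Σ (Fin t → Fin (t + s)) λ τ → Injective _≡_ _≡_ τ ×
      (∀ {a} → a ∈ as → k ≤ count (S? a) → ∃ λ c → (∀ j → τ j ≢ c) × S a c)
  select-unhit t s k {A} {S} S? as numeric
    with hitting-set S? k s (filter (λ a → k ≤? count (S? a)) as)
           (All.tabulate λ a∈ → proj₂ (∈-filter⁻ (λ a → k ≤? count (S? a)) {xs = as} a∈))
           (≤-<-trans (*-monoˡ-≤ ((t + s ∸ k) ^ s)
             (length-filter (λ a → k ≤? count (S? a)) as)) numeric)
  ... | D , ∣D∣≡s , hit
    with enumerate t (λ c → ¬? (c ∈ₗ? D)) (+-cancelʳ-≤ s t _
           (≤-trans (count-∁ (_∈ₗ? D)) (+-monoʳ-≤ _ (≤-trans (count-∈ₗ D) (≤-reflexive ∣D∣≡s)))))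
  ... | τ , τ-inj , τ∉D = τ , τ-inj , λ a∈ big → avoid (hit (∈-filter⁺ (λ a → k ≤? count (S? a)) a∈ big))
    where
      avoid : ∀ {a} → (∃ λ c → c ∈ D × S a c) → ∃ λ c → (∀ j → τ j ≢ c) × S a c
      avoid (c , c∈D , q) = c , (λ { j refl → τ∉D j c∈D }) , q

  other : Fin 2 → Fin 2
  other = Fin.opposite

  this-or-other : (i i′ : Fin 2) → i′ ≡ i ⊎ i′ ≡ other i
  this-or-other Fin.zero           Fin.zero           = inj₁ refl
  this-or-other Fin.zero           (Fin.suc Fin.zero) = inj₂ refl
  this-or-other (Fin.suc Fin.zero) Fin.zero           = inj₂ refl
  this-or-other (Fin.suc Fin.zero) (Fin.suc Fin.zero) = inj₁ refl

  pair : ∀ {A : Set} → A → A → Fin 2 → A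
  pair a b Fin.zero    = a
  pair a b (Fin.suc _) = b

  pair-injective : ∀ {A : Set} {a b : A} → a ≢ b → Injective _≡_ _≡_ (pair a b)
  pair-injective a≢b {Fin.zero}         {Fin.zero}         e = refl
  pair-injective a≢b {Fin.zero}         {Fin.suc Fin.zero} e = ⊥-elim (a≢b e)
  pair-injective a≢b {Fin.suc Fin.zero} {Fin.zero}         e = ⊥-elim (a≢b (sym e))
  pair-injective a≢b {Fin.suc Fin.zero} {Fin.suc Fin.zero} e = refl

  module Finding {n : ℕ} (H : Hypergraph3 n) where
    open Links H

    linked? : ∀ u v → Dec (1 ≤ codegree u v)
    linked? u v = 1 ≤? codegree u v

    codegree⇒≢ : ∀ {u v} → 1 ≤ codegree u v → u ≢ v
    codegree⇒≢ {u} {v} c with count>0⇒∃ (edge? u v) c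
    ... | _ , _ , (u≢v , _) , _ = u≢v

    outside-vertex : ∀ {N} k (x : Fin 2 → Fin n) (y : Fin N → Fin n) i v →
      suc k ≤ codegree (x i) v → count (λ c → edge? (x i) v (y c)) < k →
      ∃ λ w → Edge (x i) v w × (∀ i′ → w ≢ x i′) × (∀ c → w ≢ y c)
    outside-vertex {N} k x y i v large small = conclude (count>0⇒∃ E″? (+-cancelʳ-≤ k 1 (count E″?) (begin
        1 + k                                 ≤⟨ large ⟩
        count E?                              ≤⟨ count-≢ E? (x (other i)) ⟩
        count E′? + 1                         ≤⟨ +-monoˡ-≤ 1 (count-∪ E′? E″? Y? split) ⟩
        count E″? + count Y? + 1              ≡⟨ +-assoc (count E″?) (count Y?) 1 ⟩
        count E″? + (count Y? + 1)            ≡⟨ cong (count E″? +_) (+-comm (count Y?) 1) ⟩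
        count E″? + suc (count Y?)            ≤⟨ +-monoʳ-≤ (count E″?) (≤-trans (s≤s (count-image y E?)) small) ⟩
        count E″? + k                         ∎)))
      where
        open ≤-Reasoning
        E? = edge? (x i) v
        E′? = E? ∖ (Fin._≟ x (other i))
        I? : Decidable (λ w → ∃ λ c → w ≡ y c)
        I? w = Fin.any? (λ c → w Fin.≟ y c)
        Y? : Decidable (λ w → Edge (x i) v w × ∃ λ c → w ≡ y c)
        Y? w = E? w ×-dec I? w
        E″? = E′? ∖ I?
        split : ∀ {w} → Edge (x i) v w × w ≢ x (other i) →
                ((Edge (x i) v w × w ≢ x (other i)) × ¬ (∃ λ c → w ≡ y c)) ⊎ (Edge (x i) v w × ∃ λ c → w ≡ y c)
        split {w} (e , w≢) with I? w
        ... | yes q = inj₂ (e , q)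
        ... | no ¬q = inj₁ ((e , w≢) , ¬q)
        conclude : (∃ λ w → (Edge (x i) v w × w ≢ x (other i)) × ¬ (∃ λ c → w ≡ y c)) →
                   ∃ λ w → Edge (x i) v w × (∀ i′ → w ≢ x i′) × (∀ c → w ≢ y c)
        conclude (w , (e@(_ , (_ , x≢w , _) , _) , w≢) , ¬im) = w , e , avoid , λ c q → ¬im (c , q)
          where
            avoid : ∀ i′ → w ≢ x i′
            avoid i′ q with this-or-other i i′
            ... | inj₁ refl = x≢w (sym q)
            ... | inj₂ refl = w≢ q

    -- The third vertex of an edge at `x i` and a surviving y has two sources. If the link of this
    -- pair has at least k members in the neighbourhood, one of them was deleted with the hitting
    -- set and is now outside S. Otherwise the link has a member outside the neighbourhood.
    heavy⇒configuration : ∀ t s k → 2 * (t + s) * (t + s ∸ k) ^ s < (t + s) ^ s →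
      ∀ x₀ x₁ → x₀ ≢ x₁ →
      t + s ≤ count (λ y → (suc k ≤? codegree x₀ y) ×-dec (suc k ≤? codegree x₁ y)) → Configuration t
    heavy⇒configuration t s k numeric x₀ x₁ x₀≢x₁ many = build
      (enumerate (t + s) (λ y → (suc k ≤? codegree x₀ y) ×-dec (suc k ≤? codegree x₁ y)) many)
      where
        x = pair x₀ x₁
        build : (Σ (Fin (t + s) → Fin n) λ y → Injective _≡_ _≡_ y ×
                  (∀ c → suc k ≤ codegree x₀ (y c) × suc k ≤ codegree x₁ (y c))) → Configuration t
        build (y , y-inj , y-heavy) = arrange
          -- Which vertices survive is not known yet, so the links of all 2(t + s) pairs must be
          -- hit; this is the factor in `numeric`.
          (select-unhit t s k (λ (i , a) c → edge? (x i) (y a) (y c)) (pairs (t + s))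
            (subst (λ l → l * (t + s ∸ k) ^ s < (t + s) ^ s) (sym (length-pairs (t + s))) numeric))
          where
            heavy : ∀ i c → suc k ≤ codegree (x i) (y c)
            heavy Fin.zero           c = proj₁ (y-heavy c)
            heavy (Fin.suc Fin.zero) c = proj₂ (y-heavy c)
            x≢ : ∀ i c → x i ≢ y c
            x≢ i c = codegree⇒≢ (≤-trans (s≤s z≤n) (heavy i c))
            arrange : (Σ (Fin t → Fin (t + s)) λ τ → Injective _≡_ _≡_ τ ×
                        (∀ {a} → a ∈ pairs (t + s) → k ≤ count (λ c → edge? (x (proj₁ a)) (y (proj₂ a)) (y c)) →
                          ∃ λ c → (∀ j → τ j ≢ c) × Edge (x (proj₁ a)) (y (proj₂ a)) (y c))) → Configuration t
            arrange (τ , τ-inj , hit) = record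
              { x = x ; y = y ∘ τ ; z = λ i j → proj₁ (third i j)
              ; x-inj = pair-injective x₀≢x₁ ; y-inj = τ-inj ∘ y-inj
              ; edge = λ i j → proj₁ (proj₂ (third i j))
              ; x≢y = λ i j → x≢ i (τ j)
              ; z≢x = λ i j → proj₁ (proj₂ (proj₂ (third i j)))
              ; z≢y = λ i j → proj₂ (proj₂ (proj₂ (third i j)))
              }
              where
                Third : Fin 2 → Fin t → Set
                Third i j = ∃ λ w → Edge (x i) (y (τ j)) w × (∀ i′ → w ≢ x i′) × (∀ j′ → w ≢ y (τ j′))
                inside-Y : ∀ i j → (∃ λ c → (∀ j′ → τ j′ ≢ c) × Edge (x i) (y (τ j)) (y c)) → Third i j
                inside-Y i j (c , τ≢c , e) = y c , e , (λ i′ q → x≢ i′ c (sym q)) , λ j′ q → τ≢c j′ (y-inj (sym q))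
                outside-Y : ∀ i j → (∃ λ w → Edge (x i) (y (τ j)) w × (∀ i′ → w ≢ x i′) × (∀ c → w ≢ y c)) → Third i j
                outside-Y i j (w , e , w≢x , w≢y) = w , e , w≢x , λ j′ → w≢y (τ j′)
                third : ∀ i j → Third i j
                third i j = by-size (k ≤? count (λ c → edge? (x i) (y (τ j)) (y c)))
                  where
                    by-size : Dec (k ≤ count (λ c → edge? (x i) (y (τ j)) (y c))) → Third i j
                    by-size (yes big) = inside-Y i j (hit (∈-cartesianProduct⁺ (∈-allFin i) (∈-allFin (τ j))) big)
                    by-size (no ¬big) = outside-Y i j (outside-vertex k x y i (y (τ j)) (heavy i (τ j)) (≰⇒> ¬big))

    -- The arc map of the digraph to which `independent-set` is applied, hence total; the value v is
    -- a mere default for pairs that are not linked.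
    linkVertex : Fin n → Fin n → Fin n
    linkVertex u v with linked? u v
    ... | yes c = proj₁ (count>0⇒∃ (edge? u v) c)
    ... | no _  = v

    linkVertex-edge : ∀ {u v} → 1 ≤ codegree u v → Edge u v (linkVertex u v)
    linkVertex-edge {u} {v} c with linked? u v
    ... | yes c′ = proj₂ (count>0⇒∃ (edge? u v) c′)
    ... | no ¬c  = ⊥-elim (¬c c)

    -- A chosen third vertex can spoil the trace by being some other y or by being the other x.
    -- Independence in the digraph of link vertices rules out the first, and discarding the link of
    -- {x₀, x₁} rules out the second.
    linked⇒configuration : ∀ t x₀ x₁ → x₀ ≢ x₁ →
      5 * t ≤ count ((λ y → linked? x₀ y ×-dec linked? x₁ y) ∖ edge? x₀ x₁) → Configuration t
    linked⇒configuration t x₀ x₁ x₀≢x₁ many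
      with independent-set (linkVertex x₀) (linkVertex x₁) t ((λ y → linked? x₀ y ×-dec linked? x₁ y) ∖ edge? x₀ x₁) many
    ... | T , refl , good , apart = record
      { x = x ; y = y ; z = z
      ; x-inj = pair-injective x₀≢x₁
      ; y-inj = y-inj
      ; edge = edge
      ; x≢y = λ i j → codegree⇒≢ (linked i j)
      ; z≢x = z≢x
      ; z≢y = z≢y
      }
      where
        x = pair x₀ x₁
        y : Fin (length T) → Fin n
        y = lookup T
        z : Fin 2 → Fin (length T) → Fin n
        z i j = linkVertex (x i) (y j)
        property : ∀ j → (1 ≤ codegree x₀ (y j) × 1 ≤ codegree x₁ (y j)) × ¬ Edge x₀ x₁ (y j)
        property j = All.lookup good (∈-lookup j)
        linked : ∀ i j → 1 ≤ codegree (x i) (y j)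
        linked Fin.zero           j = proj₁ (proj₁ (property j))
        linked (Fin.suc Fin.zero) j = proj₂ (proj₁ (property j))
        edge : ∀ i j → Edge (x i) (y j) (z i j)
        edge i j = linkVertex-edge (linked i j)
        apart-lookup : ∀ {j j′} → j ≢ j′ → Apart (linkVertex x₀) (linkVertex x₁) (y j) (y j′)
        apart-lookup = AllPairs-lookup (λ (a , b , c , d , e) → a ∘ sym , d , e , b , c) apart
        y-inj : Injective _≡_ _≡_ y
        y-inj {j} {j′} e with j Fin.≟ j′
        ... | yes q = q
        ... | no ¬q = ⊥-elim (proj₁ (apart-lookup ¬q) (sym e))
        -- An edge through both x and `y j` would put `y j` into the discarded link.
        base : ∀ i j → ¬ Edge (x i) (y j) (x (other i))
        base Fin.zero           j e = proj₂ (property j) (edge-swap₂₃ e)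
        base (Fin.suc Fin.zero) j e = proj₂ (property j) (edge-swap₁₂ (edge-swap₂₃ e))
        z≢x : ∀ i j i′ → z i j ≢ x i′
        z≢x i j i′ q with this-or-other i i′
        ... | inj₁ refl = proj₁ (proj₂ (proj₁ (proj₂ (edge i j)))) (sym q)
        ... | inj₂ refl = base i j (subst (Edge (x i) (y j)) q (edge i j))
        z≢y : ∀ i j j′ → z i j ≢ y j′
        z≢y i j j′ q with j Fin.≟ j′
        ... | yes refl = proj₂ (proj₂ (proj₁ (proj₂ (edge i j)))) (sym q)
        z≢y Fin.zero           j j′ q | no ¬p = proj₁ (proj₂ (proj₂ (proj₂ (apart-lookup ¬p)))) (sym q)
        z≢y (Fin.suc Fin.zero) j j′ q | no ¬p = proj₂ (proj₂ (proj₂ (proj₂ (apart-lookup ¬p)))) (sym q)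

  -- Quadratic inequalities for the number of pairs

  -- Kővári–Sós–Turán; B accounts for the pairs whose codegree may exceed M.
  kővári-sós-turán : ∀ {n} (g : Fin n → Fin n → ℕ) (B : Fin n → Fin n → ℕ) M →
    (∀ u v → g u v ≤ 1) → (∀ u w → u ≢ w → ∑[ v < n ] (g u v * g w v) ≤ M + B u w) →
    let f = ∑[ u < n ] ∑[ v < n ] g u v in
    f * f ≤ n * (n * (n * M) + ∑[ u < n ] ∑[ w < n ] B u w + f)
  kővári-sós-turán {n} g B M g≤1 codegree≤ = begin
    f * f                                                           ≡⟨ cong (λ x → x * x) (∑-comm {n} {n} g) ⟩
    sum deg * sum deg                                               ≤⟨ square-sum≤ deg ⟩
    n * ∑[ v < n ] (deg v * deg v)                                  ≤⟨ *-monoʳ-≤ n (begin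
      ∑[ v < n ] (deg v * deg v)                                      ≡⟨ sum-cong-≗ (λ v → square v) ⟩
      ∑[ v < n ] ∑[ u < n ] ∑[ w < n ] (g u v * g w v)                ≡⟨ ∑-comm {n} {n} (λ v u → ∑[ w < n ] (g u v * g w v)) ⟩
      ∑[ u < n ] ∑[ v < n ] ∑[ w < n ] (g u v * g w v)                ≡⟨ sum-cong-≗ (λ u → ∑-comm {n} {n} (λ v w → g u v * g w v)) ⟩
      ∑[ u < n ] ∑[ w < n ] ∑[ v < n ] (g u v * g w v)                ≤⟨ sum-mono-≤ (λ u → sum-mono-≤ λ w → pointwise u w) ⟩
      ∑[ u < n ] ∑[ w < n ] (M + B u w + 𝟙 (w Fin.≟ u) * row u)       ≡⟨ sum-cong-≗ (λ u → expand-row u) ⟩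
      ∑[ u < n ] (n * M + ∑[ w < n ] B u w + row u)                   ≡⟨ expand ⟩
      n * (n * M) + ∑[ u < n ] ∑[ w < n ] B u w + f                   ∎) ⟩
    n * (n * (n * M) + ∑[ u < n ] ∑[ w < n ] B u w + f)             ∎
    where
      open ≤-Reasoning
      f = ∑[ u < n ] ∑[ v < n ] g u v
      deg row : Fin n → ℕ
      deg v = ∑[ u < n ] g u v
      row u = ∑[ v < n ] g u v
      square : ∀ v → deg v * deg v ≡ ∑[ u < n ] ∑[ w < n ] (g u v * g w v)
      square v = trans (sym (∑-*ʳ (deg v) (λ u → g u v))) (sum-cong-≗ λ u → sym (∑-*ˡ (g u v) (λ w → g w v)))
      -- On the diagonal the codegree is a full row sum, because g takes only the values 0 and 1.
      -- The diagonal adds up to f, which is the linear term of the conclusion.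
      pointwise : ∀ u w → ∑[ v < n ] (g u v * g w v) ≤ M + B u w + 𝟙 (w Fin.≟ u) * row u
      pointwise u w with w Fin.≟ u
      ... | no w≢u   = ≤-trans (codegree≤ u w (w≢u ∘ sym)) (m≤m+n _ _)
      ... | yes refl = ≤-trans (sum-mono-≤ λ v → ≤-trans (*-monoʳ-≤ (g u v) (g≤1 u v)) (≤-reflexive (*-identityʳ (g u v))))
                               (≤-trans (≤-reflexive (sym (*-identityˡ (row u)))) (m≤n+m (1 * row u) (M + B u u)))
      expand-row : ∀ u → ∑[ w < n ] (M + B u w + 𝟙 (w Fin.≟ u) * row u) ≡ n * M + ∑[ w < n ] B u w + row u
      expand-row u = trans (∑-distrib-+ (λ w → M + B u w) (λ w → 𝟙 (w Fin.≟ u) * row u)) (cong₂ _+_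
        (trans (∑-distrib-+ (λ _ → M) (B u)) (cong (_+ ∑[ w < n ] B u w) (sum-const n M)))
        (trans (∑-*ʳ (row u) (λ w → 𝟙 (w Fin.≟ u))) (trans (cong (_* row u) (∑-δ u)) (*-identityˡ (row u)))))
      expand : ∑[ u < n ] (n * M + ∑[ w < n ] B u w + row u) ≡ n * (n * M) + ∑[ u < n ] ∑[ w < n ] B u w + f
      expand = trans (∑-distrib-+ (λ u → n * M + ∑[ w < n ] B u w) row) (cong (_+ f)
        (trans (∑-distrib-+ (λ _ → n * M) (λ u → ∑[ w < n ] B u w)) (cong (_+ ∑[ u < n ] ∑[ w < n ] B u w) (sum-const n (n * M)))))

  -- Raising M to M + 1 pays for the linear term. If f ≤ (M + 1)cn, then f² has order n² and a large
  -- n suffices. Otherwise cnf ≤ f²/(M + 1), so the linear term moves to the left and leaves f² ·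
  -- M/(M + 1) ≤ Mn³.
  absorb-linear-term : ∀ f n m c → let M = suc m in
    f * f ≤ c * n * f + M * (n * n * n) → suc M * (c * c) ≤ n → f * f ≤ suc M * (n * n * n)
  absorb-linear-term f n m c quadratic n-large with ≤-total f (suc (suc m) * (c * n))
  ... | inj₁ small = begin
    f * f                                              ≤⟨ *-mono-≤ small small ⟩
    suc M * (c * n) * (suc M * (c * n))                ≡⟨ arrange (suc M) c n ⟩
    suc M * (suc M * (c * c) * n * n)                  ≤⟨ *-monoʳ-≤ (suc M) (*-monoˡ-≤ n (*-monoˡ-≤ n n-large)) ⟩
    suc M * (n * n * n)                                ∎
    where
      open ≤-Reasoning
      M = suc m
      arrange : ∀ p c n → p * (c * n) * (p * (c * n)) ≡ p * (p * (c * c) * n * n)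
      arrange = solve-∀
  ... | inj₂ large = *-cancelˡ-≤ M (+-cancelˡ-≤ (f * f) (M * (f * f)) (M * (suc M * (n * n * n))) (begin
    f * f + M * (f * f)                                ≤⟨ *-monoʳ-≤ (suc M) quadratic ⟩
    suc M * (c * n * f + M * (n * n * n))              ≡⟨ arrange (suc M) c n f (M * (n * n * n)) ⟩
    suc M * (c * n) * f + suc M * (M * (n * n * n))    ≤⟨ +-monoˡ-≤ (suc M * (M * (n * n * n))) (*-monoˡ-≤ f large) ⟩
    f * f + suc M * (M * (n * n * n))                  ≡⟨ cong (f * f +_) (swap (suc M) M (n * n * n)) ⟩
    f * f + M * (suc M * (n * n * n))                  ∎))
    where
      open ≤-Reasoning
      M = suc m
      arrange : ∀ p c n f x → p * (c * n * f + x) ≡ p * (c * n) * f + p * x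
      arrange = solve-∀
      swap : ∀ p q x → p * (q * x) ≡ q * (p * x)
      swap = solve-∀

  -- Charging edges to light and heavy pairs

  light-or-heavy : ∀ k d → 𝟙 (d ≤? k) ≡ 1 ⊎ 𝟙 (suc k ≤? d) ≡ 1
  light-or-heavy k d with d ≤? k
  ... | yes _   = inj₁ refl
  ... | no d≰k  = inj₂ (𝟙-yes (suc k ≤? d) (≰⇒> d≰k))

  -- Pairs of codegree zero are light as well, but they lie in no edge; so the charge k falls on
  -- linked pairs only, and these are the pairs that can be counted.
  𝟙-light*≤ : ∀ k d → 𝟙 (d ≤? k) * d ≤ k * 𝟙 (1 ≤? d)
  𝟙-light*≤ k zero = ≤-trans (≤-reflexive (*-zeroʳ (𝟙 (0 ≤? k)))) z≤n
  𝟙-light*≤ k d@(suc _) with d ≤? k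
  ... | yes d≤k = ≤-trans (≤-reflexive (*-identityˡ d)) (≤-trans d≤k (≤-reflexive (trans (sym (*-identityʳ k)) (cong (k *_) (sym (𝟙-yes (1 ≤? d) (s≤s z≤n)))))))
  ... | no _    = z≤n

  -- The last summand omits e: triangles of heavy pairs are counted whether or not they are edges,
  -- so a bound on common heavy neighbours is enough to control them.
  some-light-or-all-heavy : ∀ e {l₁ l₂ l₃ h₁ h₂ h₃} → e ≤ 1 → l₁ ≡ 1 ⊎ h₁ ≡ 1 → l₂ ≡ 1 ⊎ h₂ ≡ 1 → l₃ ≡ 1 ⊎ h₃ ≡ 1 →
                            e ≤ l₁ * e + l₂ * e + l₃ * e + h₁ * (h₂ * h₃)
  some-light-or-all-heavy e {l₂ = l₂} {l₃} {h₁} {h₂} {h₃} e≤1 (inj₁ refl) _ _ =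
    ≤-trans (≤-reflexive (sym (*-identityˡ e))) (≤-trans (m≤m+n (1 * e) (l₂ * e))
      (≤-trans (m≤m+n (1 * e + l₂ * e) (l₃ * e)) (m≤m+n (1 * e + l₂ * e + l₃ * e) (h₁ * (h₂ * h₃)))))
  some-light-or-all-heavy e {l₁} {l₃ = l₃} {h₁} {h₂} {h₃} e≤1 (inj₂ _) (inj₁ refl) _ =
    ≤-trans (≤-reflexive (sym (*-identityˡ e))) (≤-trans (m≤n+m (1 * e) (l₁ * e))
      (≤-trans (m≤m+n (l₁ * e + 1 * e) (l₃ * e)) (m≤m+n (l₁ * e + 1 * e + l₃ * e) (h₁ * (h₂ * h₃)))))
  some-light-or-all-heavy e {l₁} {l₂} {h₁ = h₁} {h₂} {h₃} e≤1 (inj₂ _) (inj₂ _) (inj₁ refl) =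
    ≤-trans (≤-reflexive (sym (*-identityˡ e))) (≤-trans (m≤n+m (1 * e) (l₁ * e + l₂ * e))
      (m≤m+n (l₁ * e + l₂ * e + 1 * e) (h₁ * (h₂ * h₃))))
  some-light-or-all-heavy e {l₁} {l₂} {l₃} e≤1 (inj₂ refl) (inj₂ refl) (inj₂ refl) =
    ≤-trans e≤1 (m≤n+m 1 (l₁ * e + l₂ * e + l₃ * e))

  𝟙-×-* : (p : Dec P) (q : Dec Q) → 𝟙 p * 𝟙 q ≤ 𝟙 (p ×-dec q)
  𝟙-×-* (yes _) (yes _) = ≤-refl
  𝟙-×-* (yes _) (no _)  = z≤n
  𝟙-×-* (no _)  _       = z≤n

  module Counting {n : ℕ} (H : Hypergraph3 n) (k : ℕ) where
    open Links H
    open Finding H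

    light heavy link : Fin n → Fin n → ℕ
    light u v = 𝟙 (codegree u v ≤? k)
    heavy u v = 𝟙 (suc k ≤? codegree u v)
    link  u v = 𝟙 (linked? u v)

    heavyPairs linkedPairs : ℕ
    heavyPairs  = ∑[ u < n ] ∑[ v < n ] heavy u v
    linkedPairs = ∑[ u < n ] ∑[ v < n ] link u v

    heavy≤link : heavyPairs ≤ linkedPairs
    heavy≤link = sum-mono-≤ λ u → sum-mono-≤ λ v →
      𝟙-mono (suc k ≤? codegree u v) (linked? u v) (≤-trans (s≤s z≤n))

    ε : Fin n → Fin n → Fin n → ℕ
    ε u v w = 𝟙 (edge? u v w)

    Σ-light : ∑[ u < n ] ∑[ v < n ] (light u v * codegree u v) ≤ k * linkedPairs
    Σ-light = begin
      ∑[ u < n ] ∑[ v < n ] (light u v * codegree u v)   ≤⟨ sum-mono-≤ (λ u → sum-mono-≤ λ v → 𝟙-light*≤ k (codegree u v)) ⟩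
      ∑[ u < n ] ∑[ v < n ] (k * link u v)               ≡⟨ sum-cong-≗ (λ u → ∑-*ˡ k (link u)) ⟩
      ∑[ u < n ] (k * ∑[ v < n ] link u v)               ≡⟨ ∑-*ˡ k (λ u → ∑[ v < n ] link u v) ⟩
      k * linkedPairs                                    ∎
      where open ≤-Reasoning

    light₁₂ : ∑[ u < n ] ∑[ v < n ] ∑[ w < n ] (light u v * ε u v w) ≤ k * linkedPairs
    light₁₂ = ≤-trans (≤-reflexive (sum-cong-≗ λ u → sum-cong-≗ λ v → ∑-*ˡ (light u v) (ε u v))) Σ-light

    light₁₃ : ∑[ u < n ] ∑[ v < n ] ∑[ w < n ] (light u w * ε u v w) ≤ k * linkedPairs
    light₁₃ = ≤-trans (≤-reflexive (sum-cong-≗ λ u → ∑-comm {n} {n} λ v w → light u w * ε u v w))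
      (≤-trans (sum-mono-≤ λ u → sum-mono-≤ λ w → sum-mono-≤ λ v →
        *-monoʳ-≤ (light u w) (𝟙-mono (edge? u v w) (edge? u w v) edge-swap₂₃)) light₁₂)

    light₂₃ : ∑[ u < n ] ∑[ v < n ] ∑[ w < n ] (light v w * ε u v w) ≤ k * linkedPairs
    light₂₃ = ≤-trans (≤-reflexive (∑-comm {n} {n} λ u v → ∑[ w < n ] (light v w * ε u v w)))
      (≤-trans (sum-mono-≤ λ v → sum-mono-≤ λ u → sum-mono-≤ λ w →
        *-monoʳ-≤ (light v w) (𝟙-mono (edge? u v w) (edge? v u w) edge-swap₁₂)) light₁₃)

    all-heavy : ∀ M → (∀ u v → u ≢ v → ∑[ w < n ] (heavy u w * heavy v w) ≤ M) →
      ∑[ u < n ] ∑[ v < n ] ∑[ w < n ] (heavy u v * (heavy u w * heavy v w)) ≤ heavyPairs * M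
    all-heavy M codegree≤M = begin
      ∑[ u < n ] ∑[ v < n ] ∑[ w < n ] (heavy u v * (heavy u w * heavy v w))   ≡⟨ sum-cong-≗ (λ u → sum-cong-≗ λ v → ∑-*ˡ (heavy u v) (λ w → heavy u w * heavy v w)) ⟩
      ∑[ u < n ] ∑[ v < n ] (heavy u v * ∑[ w < n ] (heavy u w * heavy v w))   ≤⟨ sum-mono-≤ (λ u → sum-mono-≤ λ v → bound u v) ⟩
      ∑[ u < n ] ∑[ v < n ] (heavy u v * M)                                    ≡⟨ sum-cong-≗ (λ u → ∑-*ʳ M (heavy u)) ⟩
      ∑[ u < n ] ((∑[ v < n ] heavy u v) * M)                                  ≡⟨ ∑-*ʳ M (λ u → ∑[ v < n ] heavy u v) ⟩
      heavyPairs * M                                                           ∎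
      where
        open ≤-Reasoning
        bound : ∀ u v → heavy u v * ∑[ w < n ] (heavy u w * heavy v w) ≤ heavy u v * M
        bound u v with suc k ≤? codegree u v
        ... | yes c = *-monoʳ-≤ 1 (codegree≤M u v (codegree⇒≢ (≤-trans (s≤s z≤n) c)))
        ... | no _  = z≤n

    triples≤ : ∀ M → (∀ u v → u ≢ v → ∑[ w < n ] (heavy u w * heavy v w) ≤ M) →
      triples ≤ 3 * k * linkedPairs + heavyPairs * M
    triples≤ M codegree≤M = begin
      triples                                                         ≤⟨ sum-mono-≤ (λ u → sum-mono-≤ λ v → sum-mono-≤ λ w → pointwise u v w) ⟩
      ∑[ u < n ] ∑[ v < n ] ∑[ w < n ] (a u v w + b u v w + c u v w + d u v w)
        ≡⟨ ∑³-distrib-+ (λ u v w → a u v w + b u v w + c u v w) d ⟩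
      ∑³ (λ u v w → a u v w + b u v w + c u v w) + ∑³ d               ≡⟨ cong (_+ ∑³ d) (trans (∑³-distrib-+ (λ u v w → a u v w + b u v w) c) (cong (_+ ∑³ c) (∑³-distrib-+ a b))) ⟩
      ∑³ a + ∑³ b + ∑³ c + ∑³ d                                       ≤⟨ +-mono-≤ (+-mono-≤ (+-mono-≤ light₁₂ light₁₃) light₂₃) (all-heavy M codegree≤M) ⟩
      K + K + K + heavyPairs * M                                      ≡⟨ cong (_+ heavyPairs * M) (thrice k linkedPairs) ⟩
      3 * k * linkedPairs + heavyPairs * M                            ∎
      where
        open ≤-Reasoning
        K = k * linkedPairs
        ∑³ : (Fin n → Fin n → Fin n → ℕ) → ℕ
        ∑³ f = ∑[ u < n ] ∑[ v < n ] ∑[ w < n ] f u v w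
        ∑³-distrib-+ : ∀ f g → ∑³ (λ u v w → f u v w + g u v w) ≡ ∑³ f + ∑³ g
        ∑³-distrib-+ f g = trans (sum-cong-≗ λ u → trans (sum-cong-≗ λ v → ∑-distrib-+ (f u v) (g u v))
          (∑-distrib-+ (λ v → ∑[ w < n ] f u v w) (λ v → ∑[ w < n ] g u v w)))
          (∑-distrib-+ (λ u → ∑[ v < n ] ∑[ w < n ] f u v w) (λ u → ∑[ v < n ] ∑[ w < n ] g u v w))
        a b c d : Fin n → Fin n → Fin n → ℕ
        a u v w = light u v * ε u v w
        b u v w = light u w * ε u v w
        c u v w = light v w * ε u v w
        d u v w = heavy u v * (heavy u w * heavy v w)
        pointwise : ∀ u v w → ε u v w ≤ a u v w + b u v w + c u v w + d u v w
        pointwise u v w = some-light-or-all-heavy (ε u v w) (𝟙≤1 (edge? u v w))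
          (light-or-heavy k (codegree u v)) (light-or-heavy k (codegree u w)) (light-or-heavy k (codegree v w))
        thrice : ∀ k l → k * l + k * l + k * l ≡ 3 * k * l
        thrice = solve-∀

    heavy-codegree≤ : ∀ t s → 2 * (t + s) * (t + s ∸ k) ^ s < (t + s) ^ s → ¬ ContainsK2tTrace t H →
      ∀ M → t + s ≡ suc M → ∀ u v → u ≢ v → ∑[ w < n ] (heavy u w * heavy v w) ≤ M
    heavy-codegree≤ t s numeric free M t+s≡1+M u v u≢v = ≤-trans
      (sum-mono-≤ λ w → 𝟙-×-* (suc k ≤? codegree u w) (suc k ≤? codegree v w))
      (ℕ.≤-pred (≤-trans (≰⇒> λ many → free (configuration⇒trace (heavy⇒configuration t s k numeric u v u≢v many)))
                         (≤-reflexive t+s≡1+M)))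

    -- Discarding the link of {u, v} costs at most its size. This is the error term B of
    -- `kővári-sós-turán`, and its sum over all pairs is `triples`.
    link-codegree≤ : ∀ t → ¬ ContainsK2tTrace t H → ∀ M → 5 * t ≡ suc M →
      ∀ u v → u ≢ v → ∑[ w < n ] (link u w * link v w) ≤ M + codegree u v
    link-codegree≤ t free M 5t≡1+M u v u≢v = ≤-trans
      (sum-mono-≤ λ w → 𝟙-×-* (linked? u w) (linked? v w))
      (≤-trans (count-∖ both? (edge? u v)) (+-mono-≤
        (ℕ.≤-pred (≤-trans (≰⇒> λ many → free (configuration⇒trace (linked⇒configuration t u v u≢v many))) (≤-reflexive 5t≡1+M)))
        (sum-mono-≤ λ w → ≤-trans (*-monoˡ-≤ (ε u v w) (𝟙≤1 (both? w))) (≤-reflexive (*-identityˡ (ε u v w))))))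
      where
        both? : Decidable (λ w → 1 ≤ codegree u w × 1 ≤ codegree v w)
        both? w = linked? u w ×-dec linked? v w

    record Bounds (t N : ℕ) : Set where
      field
        links heavies : ℕ
        6*edges≤ : 6 * numEdges H ≤ 3 * k * links + N * heavies
        links²   : links * links ≤ 5 * t * (n * n * n)
        heavies² : heavies * heavies ≤ N * (n * n * n)

    -- The lower bound on n adds up the demands of both uses of `absorb-linear-term`: 5t · c² for
    -- linked pairs and (t + s) · 1² for heavy ones, where c is the coefficient of the linear term
    -- for linked pairs.
    bounds : ∀ t s → 2 ≤ t → 2 * (t + s) * (t + s ∸ k) ^ s < (t + s) ^ s →
      (5 * t + (t + s)) * ((3 * k + (t + s) + 1) * (3 * k + (t + s) + 1)) ≤ n → ¬ ContainsK2tTrace t H →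
      Bounds t (t + s)
    bounds (suc (suc t′)) s (s≤s (s≤s _)) numeric n-large free = record
      { links = linkedPairs ; heavies = heavyPairs
      ; 6*edges≤ = ≤-trans 6*edges≤triples (≤-trans triples≤kN (+-monoʳ-≤ (3 * k * linkedPairs) (≤-trans (≤-reflexive (*-comm heavyPairs M)) (*-monoˡ-≤ heavyPairs (n≤1+n M)))))
      ; links² = ≤-trans (absorb-linear-term linkedPairs n (8 + 5 * t′) c linked-quadratic
                   (≤-trans (*-monoˡ-≤ (c * c) (≤-trans (≤-reflexive (sym 5t≡)) (m≤m+n (5 * t) (t + s)))) n-large)) (≤-reflexive (cong (_* (n * n * n)) (sym 5t≡)))
      ; heavies² = absorb-linear-term heavyPairs n (t′ + s) 1 heavy-quadratic
                   (≤-trans (*-mono-≤ (m≤n+m (t + s) (5 * t)) (*-mono-≤ 1≤c 1≤c)) n-large)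
      }
      where
        open ≤-Reasoning
        t = suc (suc t′)
        -- `M` is t + s - 1 and `M₅` is 5t - 1, the largest codegrees that force no trace; absorbing
        -- the linear term brings them back to t + s and 5t.
        M = suc t′ + s
        M₅ = suc (8 + 5 * t′)
        c = 3 * k + (t + s) + 1
        1≤c : 1 ≤ c
        1≤c = m≤n+m 1 (3 * k + (t + s))
        5t≡ : 5 * t ≡ suc M₅
        5t≡ = times5 t′
          where
            times5 : ∀ t → 5 * (2 + t) ≡ 10 + 5 * t
            times5 = solve-∀
        heavy-codegree : ∀ u v → u ≢ v → ∑[ w < n ] (heavy u w * heavy v w) ≤ M
        heavy-codegree = heavy-codegree≤ t s numeric free M refl
        triples≤kN : triples ≤ 3 * k * linkedPairs + heavyPairs * M
        triples≤kN = triples≤ M heavy-codegree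
        -- The accumulated error is itself linear in the number of linked pairs, since heavy pairs
        -- are linked. The remaining +1 in c is the diagonal term.
        triples≤linked : triples + linkedPairs ≤ c * linkedPairs
        triples≤linked = begin
          triples + linkedPairs                                          ≤⟨ +-monoˡ-≤ linkedPairs triples≤kN ⟩
          3 * k * linkedPairs + heavyPairs * M + linkedPairs             ≤⟨ +-monoˡ-≤ linkedPairs (+-monoʳ-≤ (3 * k * linkedPairs) (*-mono-≤ heavy≤link (n≤1+n M))) ⟩
          3 * k * linkedPairs + linkedPairs * (t + s) + linkedPairs      ≡⟨ collect (3 * k) linkedPairs (t + s) ⟩
          c * linkedPairs                                                ∎
          where
            collect : ∀ x l y → x * l + l * y + l ≡ (x + y + 1) * l
            collect = solve-∀
        linked-quadratic : linkedPairs * linkedPairs ≤ c * n * linkedPairs + M₅ * (n * n * n)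
        linked-quadratic = begin
          linkedPairs * linkedPairs                                 ≤⟨ kővári-sós-turán link codegree M₅ (λ u v → 𝟙≤1 (linked? u v)) (link-codegree≤ t free M₅ 5t≡) ⟩
          n * (n * (n * M₅) + triples + linkedPairs)                ≡⟨ cong (n *_) (+-assoc (n * (n * M₅)) triples linkedPairs) ⟩
          n * (n * (n * M₅) + (triples + linkedPairs))              ≤⟨ *-monoʳ-≤ n (+-monoʳ-≤ (n * (n * M₅)) triples≤linked) ⟩
          n * (n * (n * M₅) + c * linkedPairs)                      ≡⟨ arrange n M₅ c linkedPairs ⟩
          c * n * linkedPairs + M₅ * (n * n * n)                    ∎
          where
            arrange : ∀ n M c l → n * (n * (n * M) + c * l) ≡ c * n * l + M * (n * n * n)
            arrange = solve-∀
        heavy-quadratic : heavyPairs * heavyPairs ≤ 1 * n * heavyPairs + M * (n * n * n)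
        heavy-quadratic = begin
          heavyPairs * heavyPairs                                   ≤⟨ kővári-sós-turán heavy (λ _ _ → 0) M (λ u v → 𝟙≤1 (suc k ≤? codegree u v))
                                                                         (λ u v u≢v → ≤-trans (heavy-codegree u v u≢v) (m≤m+n M 0)) ⟩
          n * (n * (n * M) + ∑[ u < n ] ∑[ w < n ] 0 + heavyPairs)  ≡⟨ cong (λ z → n * (n * (n * M) + z + heavyPairs)) no-error ⟩
          n * (n * (n * M) + 0 + heavyPairs)                        ≡⟨ arrange n M heavyPairs ⟩
          1 * n * heavyPairs + M * (n * n * n)                      ∎
          where
            no-error : ∑[ u < n ] ∑[ w < n ] 0 ≡ 0
            no-error = trans (sum-cong-≗ {n} λ u → trans (sum-const n 0) (*-zeroʳ n)) (trans (sum-const n 0) (*-zeroʳ n))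
            arrange : ∀ n M l → n * (n * (n * M) + 0 + l) ≡ 1 * n * l + M * (n * n * n)
            arrange = solve-∀

import Data.Integer as ℤ
import Data.Integer.Properties as ℤ
open import Data.Rational using (ℚ; _+_; _*_; _<_; _≤_; 0ℚ; 1ℚ; _/_; nonNegative; positive)
open import Data.Rational.Properties
  using (toℚᵘ-injective; toℚᵘ-fromℚᵘ; toℚᵘ-homo-+; toℚᵘ-homo-*; toℚᵘ-cancel-≤; toℚᵘ-cancel-<;
         ≤-refl; ≤-reflexive; ≤-trans; ≤-total; <⇒≤; <-irrefl; <-≤-trans; ≤-<-trans; ≮⇒≥; ≰⇒>; _≤?_;
         +-comm; +-identityˡ; +-identityʳ; +-mono-≤; +-monoˡ-≤; +-monoʳ-≤; +-monoˡ-<;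
         *-assoc; *-identityˡ; *-identityʳ; *-zeroˡ; *-zeroʳ; *-distribˡ-+; *-distribʳ-+;
         *-monoˡ-≤-nonNeg; *-monoʳ-≤-nonNeg; *-monoˡ-<-pos; *-monoʳ-<-pos; *-cancelˡ-≤-pos;
         module ≤-Reasoning)
open import Data.Rational.Solver using (module +-*-Solver)
open import Data.Rational.Unnormalised as ℚᵘ using (mkℚᵘ; *≡*)
import Data.Rational.Unnormalised.Properties as ℚᵘ
open Combinatorics using (module Counting)
open +-*-Solver using (solve; _:=_; _:+_; _:*_; con)
open ≤-Reasoning

-- Naturals among the rationals, and inequalities between squares

<⇒≱ : ∀ {x y} → x < y → ¬ (y ≤ x)
<⇒≱ x<y y≤x = <-irrefl refl (<-≤-trans x<y y≤x)

ℕ→ℚ-+ : ∀ m n → ℕ→ℚ (m ℕ.+ n) ≡ ℕ→ℚ m + ℕ→ℚ n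
ℕ→ℚ-+ m n = toℚᵘ-injective (ℚᵘ.≃-trans (toℚᵘ-fromℚᵘ (mkℚᵘ (ℤ.+ (m ℕ.+ n)) 0)) (ℚᵘ.≃-sym
  (ℚᵘ.≃-trans (toℚᵘ-homo-+ (ℕ→ℚ m) (ℕ→ℚ n))
  (ℚᵘ.≃-trans (ℚᵘ.+-cong (toℚᵘ-fromℚᵘ (mkℚᵘ (ℤ.+ m) 0)) (toℚᵘ-fromℚᵘ (mkℚᵘ (ℤ.+ n) 0)))
    (*≡* (cong (ℤ._* ℤ.+ 1) (trans (cong₂ ℤ._+_ (ℤ.*-identityʳ (ℤ.+ m)) (ℤ.*-identityʳ (ℤ.+ n))) (sym (ℤ.pos-+ m n)))))))))

ℕ→ℚ-* : ∀ m n → ℕ→ℚ (m ℕ.* n) ≡ ℕ→ℚ m * ℕ→ℚ n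
ℕ→ℚ-* m n = toℚᵘ-injective (ℚᵘ.≃-trans (toℚᵘ-fromℚᵘ (mkℚᵘ (ℤ.+ (m ℕ.* n)) 0)) (ℚᵘ.≃-sym
  (ℚᵘ.≃-trans (toℚᵘ-homo-* (ℕ→ℚ m) (ℕ→ℚ n))
  (ℚᵘ.≃-trans (ℚᵘ.*-cong (toℚᵘ-fromℚᵘ (mkℚᵘ (ℤ.+ m) 0)) (toℚᵘ-fromℚᵘ (mkℚᵘ (ℤ.+ n) 0)))
    (*≡* (cong (ℤ._* ℤ.+ 1) (sym (ℤ.pos-* m n))))))))

reciprocal : ∀ k → ℕ→ℚ (suc k) * ((ℤ.+ 1) / suc k) ≡ 1ℚ
reciprocal k = toℚᵘ-injective (ℚᵘ.≃-trans (toℚᵘ-homo-* (ℕ→ℚ (suc k)) ((ℤ.+ 1) / suc k))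
  (ℚᵘ.≃-trans (ℚᵘ.*-cong (toℚᵘ-fromℚᵘ (mkℚᵘ (ℤ.+ suc k) 0)) (toℚᵘ-fromℚᵘ (mkℚᵘ (ℤ.+ 1) k)))
    (*≡* (ℤ.*-comm (ℤ.+ suc k ℤ.* ℤ.+ 1) (ℤ.+ 1) ⟫ ℤ.*-identityˡ _ ⟫ ℤ.*-identityʳ (ℤ.+ suc k)
           ⟫ sym (ℤ.*-identityˡ (ℤ.+ suc k) ) ⟫ cong (λ d → ℤ.+ 1 ℤ.* ℤ.+ d) (sym (ℕ.*-identityˡ (suc k)))))))
  where
    infixl 5 _⟫_
    _⟫_ = trans

ℕ→ℚ-mono-≤ : ∀ {m n} → m ℕ.≤ n → ℕ→ℚ m ≤ ℕ→ℚ n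
ℕ→ℚ-mono-≤ {m} {n} m≤n = toℚᵘ-cancel-≤ (ℚᵘ.≤-respˡ-≃ (ℚᵘ.≃-sym (toℚᵘ-fromℚᵘ (mkℚᵘ (ℤ.+ m) 0)))
  (ℚᵘ.≤-respʳ-≃ (ℚᵘ.≃-sym (toℚᵘ-fromℚᵘ (mkℚᵘ (ℤ.+ n) 0))) (ℚᵘ.*≤* (ℤ.*-monoʳ-≤-nonNeg (ℤ.+ 1) (ℤ.+≤+ m≤n)))))

ℕ→ℚ-mono-< : ∀ {m n} → m ℕ.< n → ℕ→ℚ m < ℕ→ℚ n
ℕ→ℚ-mono-< {m} {n} m<n = toℚᵘ-cancel-< (ℚᵘ.<-respˡ-≃ (ℚᵘ.≃-sym (toℚᵘ-fromℚᵘ (mkℚᵘ (ℤ.+ m) 0)))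
  (ℚᵘ.<-respʳ-≃ (ℚᵘ.≃-sym (toℚᵘ-fromℚᵘ (mkℚᵘ (ℤ.+ n) 0))) (ℚᵘ.*<* (ℤ.*-monoʳ-<-pos (ℤ.+ 1) (ℤ.+<+ m<n)))))

ℕ→ℚ-cancel-≤ : ∀ {m n} → ℕ→ℚ m ≤ ℕ→ℚ n → m ℕ.≤ n
ℕ→ℚ-cancel-≤ {m} {n} p = ℕ.≮⇒≥ λ n<m → <⇒≱ (ℕ→ℚ-mono-< {n} {m} n<m) p

ℕ→ℚ-cancel-< : ∀ {m n} → ℕ→ℚ m < ℕ→ℚ n → m ℕ.< n
ℕ→ℚ-cancel-< {m} {n} p = ℕ.≰⇒> λ n≤m → <⇒≱ p (ℕ→ℚ-mono-≤ {n} {m} n≤m)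

0≤ℕ→ℚ : ∀ m → 0ℚ ≤ ℕ→ℚ m
0≤ℕ→ℚ m = ℕ→ℚ-mono-≤ {0} {m} z≤n

*-monoʳ : ∀ {x y} z → 0ℚ ≤ z → x ≤ y → z * x ≤ z * y
*-monoʳ z 0≤z = *-monoˡ-≤-nonNeg z {{nonNegative 0≤z}}

*-monoˡ : ∀ {x y} z → 0ℚ ≤ z → x ≤ y → x * z ≤ y * z
*-monoˡ z 0≤z = *-monoʳ-≤-nonNeg z {{nonNegative 0≤z}}

0≤* : ∀ {x y} → 0ℚ ≤ x → 0ℚ ≤ y → 0ℚ ≤ x * y
0≤* {x} {y} 0≤x 0≤y = subst (_≤ x * y) (*-zeroˡ y) (*-monoˡ y 0≤y 0≤x)

0≤+ : ∀ {x y} → 0ℚ ≤ x → 0ℚ ≤ y → 0ℚ ≤ x + y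
0≤+ {x} {y} = +-mono-≤ {0ℚ} {x} {0ℚ} {y}

*-mono-≤-nonNeg : ∀ {x y z w} → 0ℚ ≤ z → 0ℚ ≤ y → x ≤ y → z ≤ w → x * z ≤ y * w
*-mono-≤-nonNeg {y = y} {z} 0≤z 0≤y x≤y z≤w = ≤-trans (*-monoˡ z 0≤z x≤y) (*-monoʳ y 0≤y z≤w)

≤-+ʳ : ∀ {x y} → 0ℚ ≤ y → x ≤ x + y
≤-+ʳ {x} {y} 0≤y = subst (_≤ x + y) (+-identityʳ x) (+-monoʳ-≤ x 0≤y)

+-cancelʳ-≤ : ∀ z {x y} → x + z ≤ y + z → x ≤ y
+-cancelʳ-≤ z {x} {y} p = ≮⇒≥ λ y<x → <⇒≱ (+-monoˡ-< z y<x) p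

square-cancel-≤ : ∀ {x y} → 0ℚ ≤ y → x * x ≤ y * y → x ≤ y
square-cancel-≤ {x} {y} 0≤y x²≤y² = ≮⇒≥ λ y<x → <⇒≱ (begin-strict
  y * y  ≤⟨ *-monoʳ y 0≤y (<⇒≤ y<x) ⟩
  y * x  <⟨ *-monoˡ-<-pos x {{positive (≤-<-trans 0≤y y<x)}} y<x ⟩
  x * x  ∎) x²≤y²

-- √ is additive up to scale: x ≤ p√z and y ≤ q√z give x + y ≤ (p + q)√z.
square-+-≤ : ∀ {x y p q z} → 0ℚ ≤ x → 0ℚ ≤ y → 0ℚ ≤ p → 0ℚ ≤ q → 0ℚ ≤ z →
             x * x ≤ p * p * z → y * y ≤ q * q * z → (x + y) * (x + y) ≤ (p + q) * (p + q) * z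
square-+-≤ {x} {y} {p} {q} {z} 0≤x 0≤y 0≤p 0≤q 0≤z hx hy = begin
  (x + y) * (x + y)                                          ≡⟨ solve 2 (λ x y → (x :+ y) :* (x :+ y) := x :* x :+ y :* y :+ (x :* y :+ x :* y)) refl x y ⟩
  x * x + y * y + (x * y + x * y)                            ≤⟨ +-mono-≤ (+-mono-≤ hx hy) (+-mono-≤ xy≤ xy≤) ⟩
  p * p * z + q * q * z + (p * q * z + p * q * z)            ≡⟨ solve 3 (λ p q z → p :* p :* z :+ q :* q :* z :+ (p :* q :* z :+ p :* q :* z) := (p :+ q) :* (p :+ q) :* z) refl p q z ⟩
  (p + q) * (p + q) * z                                      ∎
  where
    -- The mixed term needs no root of z: the product of the two hypotheses is a comparison of the
    -- squares of xy and pqz.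
    xy≤ : x * y ≤ p * q * z
    xy≤ = square-cancel-≤ (0≤* (0≤* 0≤p 0≤q) 0≤z) (begin
      x * y * (x * y)              ≡⟨ solve 2 (λ x y → x :* y :* (x :* y) := x :* x :* (y :* y)) refl x y ⟩
      x * x * (y * y)              ≤⟨ *-mono-≤-nonNeg (0≤* 0≤y 0≤y) (0≤* (0≤* 0≤p 0≤p) 0≤z) hx hy ⟩
      p * p * z * (q * q * z)      ≡⟨ solve 3 (λ p q z → p :* p :* z :* (q :* q :* z) := p :* q :* z :* (p :* q :* z)) refl p q z ⟩
      p * q * z * (p * q * z)      ∎)

-- Partial sums of the exponential series

0≤1/ : ∀ k → 0ℚ ≤ (ℤ.+ 1) / suc k
0≤1/ k = toℚᵘ-cancel-≤ (ℚᵘ.≤-respʳ-≃ (ℚᵘ.≃-sym (toℚᵘ-fromℚᵘ (mkℚᵘ (ℤ.+ 1) k))) (ℚᵘ.*≤* (ℤ.+≤+ z≤n)))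

0≤expTerm : ∀ {x} → 0ℚ ≤ x → ∀ k → 0ℚ ≤ expTerm x k
0≤expTerm 0≤x zero    = ℕ→ℚ-mono-≤ {0} {1} z≤n
0≤expTerm 0≤x (suc k) = 0≤* (0≤* (0≤expTerm 0≤x k) 0≤x) (0≤1/ k)

0≤expPartial : ∀ {x} → 0ℚ ≤ x → ∀ K → 0ℚ ≤ expPartial x K
0≤expPartial 0≤x zero    = ≤-refl
0≤expPartial 0≤x (suc K) = 0≤+ (0≤expPartial 0≤x K) (0≤expTerm 0≤x K)

-- Convexity of x^(k+1)/(k+1)!, whose derivative is x^k/k!.
expTerm-convex : ∀ {y h} → 0ℚ ≤ y → 0ℚ ≤ h → ∀ k →
                 expTerm (y + h) (suc k) ≤ expTerm y (suc k) + h * expTerm (y + h) k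
expTerm-convex {y} {h} 0≤y 0≤h zero = ≤-reflexive
  (solve 2 (λ y h → con 1ℚ :* (y :+ h) :* con 1ℚ := con 1ℚ :* y :* con 1ℚ :+ h :* con 1ℚ) refl y h)
expTerm-convex {y} {h} 0≤y 0≤h (suc k) = begin
  A * (y + h) * r                      ≡⟨ solve 4 (λ A y h r → A :* (y :+ h) :* r := A :* (y :* r) :+ h :* (A :* r)) refl A y h r ⟩
  A * (y * r) + h * (A * r)            ≤⟨ +-monoˡ-≤ (h * (A * r)) (*-monoˡ (y * r) (0≤* 0≤y 0≤r) (expTerm-convex 0≤y 0≤h k)) ⟩
  (B + h * C) * (y * r) + h * (A * r)  ≡⟨ solve 6 (λ A B C y h r → (B :+ h :* C) :* (y :* r) :+ h :* (A :* r) := B :* y :* r :+ h :* ((C :* y :+ A) :* r)) refl A B C y h r ⟩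
  -- As x · x^k/k! equals (k + 1) · x^(k+1)/(k + 1)!, the bracket `C * y + A` is at most (k + 2)A,
  -- and r = 1/(k + 2) cancels the factor.
  B * y * r + h * ((C * y + A) * r)    ≤⟨ +-monoʳ-≤ (B * y * r) (*-monoʳ h 0≤h (begin
    (C * y + A) * r                      ≤⟨ *-monoˡ r 0≤r (+-monoˡ-≤ A (*-monoʳ C 0≤C (≤-+ʳ 0≤h))) ⟩
    (C * (y + h) + A) * r                ≡⟨ cong (λ z → (z + A) * r) C*≡ ⟩
    (ℕ→ℚ (suc k) * A + A) * r            ≡⟨ solve 3 (λ n A r → (n :* A :+ A) :* r := (n :+ con 1ℚ) :* r :* A) refl (ℕ→ℚ (suc k)) A r ⟩
    (ℕ→ℚ (suc k) + 1ℚ) * r * A           ≡⟨ cong (λ n → n * r * A) (trans (+-comm (ℕ→ℚ (suc k)) 1ℚ) (sym (ℕ→ℚ-+ 1 (suc k)))) ⟩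
    ℕ→ℚ (suc (suc k)) * r * A            ≡⟨ cong (_* A) (reciprocal (suc k)) ⟩
    1ℚ * A                               ≡⟨ *-identityˡ A ⟩
    A                                    ∎)) ⟩
  B * y * r + h * A                    ∎
  where
    A = expTerm (y + h) (suc k)
    B = expTerm y (suc k)
    C = expTerm (y + h) k
    r = (ℤ.+ 1) / suc (suc k)
    r′ = (ℤ.+ 1) / suc k
    0≤r = 0≤1/ (suc k)
    0≤C = 0≤expTerm (0≤+ 0≤y 0≤h) k
    C*≡ : C * (y + h) ≡ ℕ→ℚ (suc k) * A
    C*≡ = begin-equality
      C * (y + h)                              ≡⟨ *-identityʳ _ ⟨
      C * (y + h) * 1ℚ                         ≡⟨ cong (C * (y + h) *_) (reciprocal k) ⟨
      C * (y + h) * (ℕ→ℚ (suc k) * r′)         ≡⟨ solve 4 (λ C x n r → C :* x :* (n :* r) := n :* (C :* x :* r)) refl C (y + h) (ℕ→ℚ (suc k)) r′ ⟩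
      ℕ→ℚ (suc k) * (C * (y + h) * r′)         ∎

-- A truncated form of (1 - h)e^(y+h) ≤ e^y. The derivative of a partial sum is the partial sum with
-- one term fewer, which is what `shifted` uses; restoring that nonnegative term keeps the same K on
-- both sides, so that the estimate can be iterated.
expPartial-convex : ∀ {y h} → 0ℚ ≤ y → 0ℚ ≤ h → ∀ K →
                    expPartial (y + h) K ≤ expPartial y K + h * expPartial (y + h) K
expPartial-convex {y} {h} 0≤y 0≤h zero = ≤-reflexive (solve 1 (λ h → con 0ℚ := con 0ℚ :+ h :* con 0ℚ) refl h)
expPartial-convex {y} {h} 0≤y 0≤h (suc K) = ≤-trans (shifted K)
  (+-monoʳ-≤ (expPartial y (suc K)) (*-monoʳ h 0≤h (≤-+ʳ (0≤expTerm (0≤+ 0≤y 0≤h) K))))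
  where
    shifted : ∀ K → expPartial (y + h) (suc K) ≤ expPartial y (suc K) + h * expPartial (y + h) K
    shifted zero    = ≤-reflexive (solve 1 (λ h → con 0ℚ :+ con 1ℚ := con 0ℚ :+ con 1ℚ :+ h :* con 0ℚ) refl h)
    shifted (suc K) = begin
      E + T                          ≤⟨ +-mono-≤ (shifted K) (expTerm-convex 0≤y 0≤h K) ⟩
      (F + h * G) + (U + h * V)      ≡⟨ solve 5 (λ F h G U V → (F :+ h :* G) :+ (U :+ h :* V) := F :+ U :+ h :* (G :+ V)) refl F h G U V ⟩
      F + U + h * (G + V)            ∎
      where
        E = expPartial (y + h) (suc K)
        T = expTerm (y + h) (suc K)
        F = expPartial y (suc K)
        U = expTerm y (suc K)
        G = expPartial (y + h) K
        V = expTerm (y + h) K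

expPartial-0 : ∀ K → expPartial 0ℚ K ≤ 1ℚ
expPartial-0 zero    = 0≤ℕ→ℚ 1
expPartial-0 (suc K) = ≤-reflexive (at-0 K)
  where
    at-0 : ∀ K → expPartial 0ℚ (suc K) ≡ 1ℚ
    at-0 zero    = refl
    at-0 (suc K) = trans (cong₂ _+_ (at-0 K)
      (trans (cong (_* ((ℤ.+ 1) / suc K)) (*-zeroʳ (expTerm 0ℚ K))) (*-zeroˡ ((ℤ.+ 1) / suc K)))) refl

-- With t/N ≤ 1 − h, this is (1 − h)^j · e^{jh} ≤ 1.
exp-power-bound : ∀ {h} → 0ℚ ≤ h → ∀ t N → ℕ→ℚ t + h * ℕ→ℚ N ≤ ℕ→ℚ N →
  ∀ K j → ℕ→ℚ (t ℕ.^ j) * expPartial (ℕ→ℚ j * h) K ≤ ℕ→ℚ (N ℕ.^ j)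
exp-power-bound {h} 0≤h t N t≤ K zero = begin
  1ℚ * expPartial (0ℚ * h) K  ≡⟨ trans (*-identityˡ _) (cong (λ x → expPartial x K) (*-zeroˡ h)) ⟩
  expPartial 0ℚ K             ≤⟨ expPartial-0 K ⟩
  1ℚ                          ∎
exp-power-bound {h} 0≤h t N t≤ K (suc j) = begin
  ℕ→ℚ (t ℕ.^ suc j) * expPartial (ℕ→ℚ (suc j) * h) K   ≡⟨ cong₂ (λ p x → p * expPartial x K) (trans (cong ℕ→ℚ (ℕ.*-comm t (t ℕ.^ j))) (ℕ→ℚ-* (t ℕ.^ j) t)) next ⟩
  ℕ→ℚ (t ℕ.^ j) * τ * E′                               ≡⟨ *-assoc (ℕ→ℚ (t ℕ.^ j)) τ E′ ⟩
  ℕ→ℚ (t ℕ.^ j) * (τ * E′)                             ≤⟨ *-monoʳ (ℕ→ℚ (t ℕ.^ j)) (0≤ℕ→ℚ (t ℕ.^ j)) τE′≤ ⟩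
  ℕ→ℚ (t ℕ.^ j) * (ν * E)                              ≡⟨ solve 3 (λ p n e → p :* (n :* e) := n :* (p :* e)) refl (ℕ→ℚ (t ℕ.^ j)) ν E ⟩
  ν * (ℕ→ℚ (t ℕ.^ j) * E)                              ≤⟨ *-monoʳ ν (0≤ℕ→ℚ N) (exp-power-bound 0≤h t N t≤ K j) ⟩
  ν * ℕ→ℚ (N ℕ.^ j)                                    ≡⟨ ℕ→ℚ-* N (N ℕ.^ j) ⟨
  ℕ→ℚ (N ℕ.^ suc j)                                    ∎
  where
    τ = ℕ→ℚ t
    ν = ℕ→ℚ N
    y = ℕ→ℚ j * h
    0≤y : 0ℚ ≤ y
    0≤y = 0≤* (0≤ℕ→ℚ j) 0≤h
    E = expPartial y K
    E′ = expPartial (y + h) K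
    next : ℕ→ℚ (suc j) * h ≡ y + h
    next = trans (cong (_* h) (ℕ→ℚ-+ 1 j)) (solve 2 (λ j h → (con 1ℚ :+ j) :* h := j :* h :+ h) refl (ℕ→ℚ j) h)
    -- This combines τ ≤ (1 - h)ν with (1 - h)E′ ≤ E. Adding hνE′ to both sides avoids subtraction.
    τE′≤ : τ * E′ ≤ ν * E
    τE′≤ = +-cancelʳ-≤ (h * ν * E′) (begin
      τ * E′ + h * ν * E′      ≡⟨ *-distribʳ-+ E′ τ (h * ν) ⟨
      (τ + h * ν) * E′         ≤⟨ *-monoˡ E′ (0≤expPartial (0≤+ 0≤y 0≤h) K) t≤ ⟩
      ν * E′                   ≤⟨ *-monoʳ ν (0≤ℕ→ℚ N) (expPartial-convex 0≤y 0≤h K) ⟩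
      ν * (E + h * E′)         ≡⟨ solve 4 (λ n e h f → n :* (e :+ h :* f) := n :* e :+ h :* n :* f) refl ν E h E′ ⟩
      ν * E + h * ν * E′       ∎)

-- Choice of s and k

ℕ→ℚ-cube : ∀ n → ℕ→ℚ (n ℕ.* n ℕ.* n) ≡ ℕ→ℚ n * ℕ→ℚ n * ℕ→ℚ n
ℕ→ℚ-cube n = trans (ℕ→ℚ-* (n ℕ.* n) n) (cong (_* ℕ→ℚ n) (ℕ→ℚ-* n n))

-- The costs are those of the light and the heavy edges: 45 = 3² · 5, 1600 = 40², and 40 + 15 = 55.
record Parameters (t : ℕ) (a b : ℚ) : Set where
  field
    s k        : ℕ
    numeric    : 2 ℕ.* (t ℕ.+ s) ℕ.* (t ℕ.+ s ℕ.∸ k) ℕ.^ s ℕ.< (t ℕ.+ s) ℕ.^ s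
    light-cost : ℕ→ℚ (45 ℕ.* (k ℕ.* k)) ≤ ℕ→ℚ 1600 * (ℕ→ℚ t * (b * b))
    heavy-cost : ℕ→ℚ ((t ℕ.+ s) ℕ.* (t ℕ.+ s) ℕ.* (t ℕ.+ s))
                   ≤ (a + ℕ→ℚ 15 * ℕ→ℚ t * b) * (a + ℕ→ℚ 15 * ℕ→ℚ t * b)

-- The budgets 30 = 2 · 15 and 225 = 15² are the coefficients in the expansion of (a + 15tb)². Here
-- x and y stand for the excess of (t + s)³ over t³, sorted by order in b.
heavy-budget : ∀ {a b x y} t → 0ℚ ≤ a → 0ℚ ≤ b → x ≤ ℕ→ℚ 30 * (a * (ℕ→ℚ t * b)) →
               y ≤ ℕ→ℚ 225 * (ℕ→ℚ t * ℕ→ℚ t * (b * b)) → ℕ→ℚ (t ℕ.* t ℕ.* t) ≤ a * a →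
               ℕ→ℚ (t ℕ.* t ℕ.* t) + (x + y) ≤ (a + ℕ→ℚ 15 * ℕ→ℚ t * b) * (a + ℕ→ℚ 15 * ℕ→ℚ t * b)
heavy-budget {a} {b} {x} {y} t 0≤a 0≤b x≤ y≤ t³≤a² = begin
  ℕ→ℚ (t ℕ.* t ℕ.* t) + (x + y)                                                   ≤⟨ +-mono-≤ t³≤a² (+-mono-≤ x≤ y≤) ⟩
  a * a + (ℕ→ℚ 30 * (a * (τ * b)) + ℕ→ℚ 225 * (τ * τ * (b * b)))                  ≡⟨ solve 3 (λ a τ b → a :* a :+ (con (ℕ→ℚ 30) :* (a :* (τ :* b)) :+ con (ℕ→ℚ 225) :* (τ :* τ :* (b :* b)))
                                                                                       := (a :+ con (ℕ→ℚ 15) :* τ :* b) :* (a :+ con (ℕ→ℚ 15) :* τ :* b)) refl a τ b ⟩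
  (a + ℕ→ℚ 15 * τ * b) * (a + ℕ→ℚ 15 * τ * b)                                     ∎
  where τ = ℕ→ℚ t

-- With k = t + s = t + 1 a large set is the whole neighbourhood, so any single point hits it. The
-- costs fit because b² ≥ t/25: 45(t + 1)² ≤ 64t² and 64 · 25 = 1600, while (t + 1)³ exceeds t³ by
-- at most t³ ≤ 25t²b².
parameters-large-b : ∀ t → 14 ℕ.≤ t → ∀ a b → 0ℚ ≤ a → 0ℚ ≤ b → ℕ→ℚ (t ℕ.* t ℕ.* t) ≤ a * a →
                     ℕ→ℚ t ≤ ℕ→ℚ 25 * (b * b) → Parameters t a b
parameters-large-b t 14≤t a b 0≤a 0≤b t³≤a² τ≤25β = record
  { s = 1 ; k = t ℕ.+ 1
  ; numeric = subst (λ d → 2 ℕ.* (t ℕ.+ 1) ℕ.* (d ℕ.^ 1) ℕ.< (t ℕ.+ 1) ℕ.^ 1) (sym (ℕ.n∸n≡0 (t ℕ.+ 1)))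
      (subst (ℕ._< (t ℕ.+ 1) ℕ.^ 1) (sym (ℕ.*-zeroʳ (2 ℕ.* (t ℕ.+ 1))))
        (subst (0 ℕ.<_) (sym (ℕ.*-identityʳ (t ℕ.+ 1))) (ℕ.m≤n+m 1 t)))
  ; light-cost = begin
      ℕ→ℚ (45 ℕ.* ((t ℕ.+ 1) ℕ.* (t ℕ.+ 1)))   ≤⟨ ℕ→ℚ-mono-≤ {45 ℕ.* ((t ℕ.+ 1) ℕ.* (t ℕ.+ 1))} {64 ℕ.* (t ℕ.* t)} square≤ ⟩
      ℕ→ℚ (64 ℕ.* (t ℕ.* t))                   ≡⟨ trans (ℕ→ℚ-* 64 (t ℕ.* t)) (cong (ℕ→ℚ 64 *_) (ℕ→ℚ-* t t)) ⟩
      ℕ→ℚ 64 * (τ * τ)                         ≤⟨ *-monoʳ (ℕ→ℚ 64) (0≤ℕ→ℚ 64) (*-monoʳ τ (0≤ℕ→ℚ t) τ≤25β) ⟩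
      ℕ→ℚ 64 * (τ * (ℕ→ℚ 25 * (b * b)))        ≡⟨ solve 2 (λ τ β → con (ℕ→ℚ 64) :* (τ :* (con (ℕ→ℚ 25) :* β)) := con (ℕ→ℚ 1600) :* (τ :* β)) refl τ (b * b) ⟩
      ℕ→ℚ 1600 * (τ * (b * b))                 ∎
  ; heavy-cost = begin
      ℕ→ℚ ((t ℕ.+ 1) ℕ.* (t ℕ.+ 1) ℕ.* (t ℕ.+ 1))   ≤⟨ ℕ→ℚ-mono-≤ {(t ℕ.+ 1) ℕ.* (t ℕ.+ 1) ℕ.* (t ℕ.+ 1)} {t ℕ.* t ℕ.* t ℕ.+ t ℕ.* t ℕ.* t} cube≤ ⟩
      ℕ→ℚ (t ℕ.* t ℕ.* t ℕ.+ t ℕ.* t ℕ.* t)         ≡⟨ trans (ℕ→ℚ-+ (t ℕ.* t ℕ.* t) (t ℕ.* t ℕ.* t)) (cong (λ x → ℕ→ℚ (t ℕ.* t ℕ.* t) + x) (sym (+-identityˡ _))) ⟩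
      ℕ→ℚ (t ℕ.* t ℕ.* t) + (0ℚ + ℕ→ℚ (t ℕ.* t ℕ.* t))  ≤⟨ heavy-budget t 0≤a 0≤b
            (0≤* (0≤ℕ→ℚ 30) (0≤* 0≤a (0≤* (0≤ℕ→ℚ t) 0≤b))) cube-budget t³≤a² ⟩
      (a + ℕ→ℚ 15 * τ * b) * (a + ℕ→ℚ 15 * τ * b)   ∎
  }
  where
    τ = ℕ→ℚ t
    0≤ττβ : 0ℚ ≤ τ * τ * (b * b)
    0≤ττβ = 0≤* (0≤* (0≤ℕ→ℚ t) (0≤ℕ→ℚ t)) (0≤* 0≤b 0≤b)
    cube-budget : ℕ→ℚ (t ℕ.* t ℕ.* t) ≤ ℕ→ℚ 225 * (τ * τ * (b * b))
    cube-budget = begin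
      ℕ→ℚ (t ℕ.* t ℕ.* t)                  ≡⟨ ℕ→ℚ-cube t ⟩
      τ * τ * τ                            ≤⟨ *-monoʳ (τ * τ) (0≤* (0≤ℕ→ℚ t) (0≤ℕ→ℚ t)) τ≤25β ⟩
      τ * τ * (ℕ→ℚ 25 * (b * b))           ≡⟨ solve 2 (λ τ β → τ :* τ :* (con (ℕ→ℚ 25) :* β) := con (ℕ→ℚ 25) :* (τ :* τ :* β)) refl τ (b * b) ⟩
      ℕ→ℚ 25 * (τ * τ * (b * b))           ≤⟨ *-monoˡ (τ * τ * (b * b)) 0≤ττβ (ℕ→ℚ-mono-≤ {25} {225} (ℕ.m≤m+n 25 200)) ⟩
      ℕ→ℚ 225 * (τ * τ * (b * b))          ∎
    -- After substituting t = 14 + x the difference of the two sides is a polynomial in x with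
    -- nonnegative coefficients, so both inequalities become ring identities.
    shift : (P : ℕ → Set) → (∀ x → P (14 ℕ.+ x)) → P t
    shift P f = subst P (ℕ.m+[n∸m]≡n 14≤t) (f (t ℕ.∸ 14))
    square≤ : 45 ℕ.* ((t ℕ.+ 1) ℕ.* (t ℕ.+ 1)) ℕ.≤ 64 ℕ.* (t ℕ.* t)
    square≤ = shift (λ t → 45 ℕ.* ((t ℕ.+ 1) ℕ.* (t ℕ.+ 1)) ℕ.≤ 64 ℕ.* (t ℕ.* t))
      λ x → ℕ.≤-trans (ℕ.m≤m+n _ (2419 ℕ.+ 442 ℕ.* x ℕ.+ 19 ℕ.* (x ℕ.* x))) (ℕ.≤-reflexive (identity x))
      where
        identity : ∀ x → 45 ℕ.* ((14 ℕ.+ x ℕ.+ 1) ℕ.* (14 ℕ.+ x ℕ.+ 1)) ℕ.+ (2419 ℕ.+ 442 ℕ.* x ℕ.+ 19 ℕ.* (x ℕ.* x))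
                           ≡ 64 ℕ.* ((14 ℕ.+ x) ℕ.* (14 ℕ.+ x))
        identity = ℕ-Ring.solve-∀
    cube≤ : (t ℕ.+ 1) ℕ.* (t ℕ.+ 1) ℕ.* (t ℕ.+ 1) ℕ.≤ t ℕ.* t ℕ.* t ℕ.+ t ℕ.* t ℕ.* t
    cube≤ = shift (λ t → (t ℕ.+ 1) ℕ.* (t ℕ.+ 1) ℕ.* (t ℕ.+ 1) ℕ.≤ t ℕ.* t ℕ.* t ℕ.+ t ℕ.* t ℕ.* t)
      λ x → ℕ.≤-trans (ℕ.m≤m+n _ (2113 ℕ.+ 501 ℕ.* x ℕ.+ 39 ℕ.* (x ℕ.* x) ℕ.+ x ℕ.* x ℕ.* x)) (ℕ.≤-reflexive (identity x))
      where
        identity : ∀ x → (14 ℕ.+ x ℕ.+ 1) ℕ.* (14 ℕ.+ x ℕ.+ 1) ℕ.* (14 ℕ.+ x ℕ.+ 1) ℕ.+ (2113 ℕ.+ 501 ℕ.* x ℕ.+ 39 ℕ.* (x ℕ.* x) ℕ.+ x ℕ.* x ℕ.* x)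
                           ≡ (14 ℕ.+ x) ℕ.* (14 ℕ.+ x) ℕ.* (14 ℕ.+ x) ℕ.+ (14 ℕ.+ x) ℕ.* (14 ℕ.+ x) ℕ.* (14 ℕ.+ x)
        identity = ℕ-Ring.solve-∀

-- Descent from a known upper bound u of the root. Since q is positive its rounded-up root is
-- positive too and can be returned as `suc r`.
⌈√⌉ : ∀ {q} → 0ℚ < q → ∀ u → q ≤ ℕ→ℚ (u ℕ.* u) →
      Σ ℕ λ r → ℕ→ℚ (r ℕ.* r) < q × q ≤ ℕ→ℚ (suc r ℕ.* suc r)
⌈√⌉ 0<q zero q≤0 = ⊥-elim (<⇒≱ 0<q q≤0)
⌈√⌉ {q} 0<q (suc u) q≤ with q ≤? ℕ→ℚ (u ℕ.* u)
... | yes q≤u² = ⌈√⌉ 0<q u q≤u²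
... | no q≰u²  = u , ≰⇒> q≰u² , q≤

-- Convexity at 0 gives E ≤ 1 + xE for every partial sum E, so x ≤ 1/2 would give E ≤ 2 ≤ t. It
-- keeps b√t away from 0, so that rounding it up loses only a constant factor.
LtExp⇒1<2x : ∀ {t x} → 2 ℕ.≤ t → 0ℚ ≤ x → LtExp t x → 1ℚ < x + x
LtExp⇒1<2x {t} {x} 2≤t 0≤x (K , t<E) = ≰⇒> λ 2x≤1 → <⇒≱ 2<E (E≤2 2x≤1)
  where
    E = expPartial x K
    2<E : ℕ→ℚ 2 < E
    2<E = ≤-<-trans (ℕ→ℚ-mono-≤ {2} {t} 2≤t) t<E
    0≤E : 0ℚ ≤ E
    0≤E = 0≤expPartial 0≤x K
    E≤1+xE : E ≤ 1ℚ + x * E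
    E≤1+xE = ≤-trans (subst (λ z → expPartial z K ≤ expPartial 0ℚ K + x * expPartial z K) (+-identityˡ x)
                        (expPartial-convex ≤-refl 0≤x K))
                     (+-monoˡ-≤ (x * E) (expPartial-0 K))
    E≤2 : x + x ≤ 1ℚ → E ≤ ℕ→ℚ 2
    E≤2 2x≤1 = +-cancelʳ-≤ E (begin
      E + E                                ≤⟨ +-mono-≤ E≤1+xE E≤1+xE ⟩
      1ℚ + x * E + (1ℚ + x * E)            ≡⟨ solve 2 (λ x e → con 1ℚ :+ x :* e :+ (con 1ℚ :+ x :* e) := con (ℕ→ℚ 2) :+ (x :+ x) :* e) refl x E ⟩
      ℕ→ℚ 2 + (x + x) * E                  ≤⟨ +-monoʳ-≤ (ℕ→ℚ 2) (*-monoˡ E 0≤E 2x≤1) ⟩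
      ℕ→ℚ 2 + 1ℚ * E                       ≡⟨ cong (ℕ→ℚ 2 +_) (*-identityˡ E) ⟩
      ℕ→ℚ 2 + E                            ∎)

-- The hitting-set condition follows from squaring t · (t/N)^r < 1.
numeric-from-power : ∀ t r → 4 ℕ.≤ t → r ℕ.+ r ℕ.≤ t → let N = t ℕ.+ (r ℕ.+ r) in
  t ℕ.^ r ℕ.* t ℕ.< N ℕ.^ r →
  2 ℕ.* N ℕ.* (N ℕ.∸ (r ℕ.+ r)) ℕ.^ (r ℕ.+ r) ℕ.< N ℕ.^ (r ℕ.+ r)
numeric-from-power t r 4≤t 2r≤t power = subst (λ d → 2 ℕ.* N ℕ.* d ℕ.^ (r ℕ.+ r) ℕ.< N ℕ.^ (r ℕ.+ r))
  (sym (ℕ.m+n∸n≡m t (r ℕ.+ r))) (ℕR.begin-strict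
    2 ℕ.* N ℕ.* t ℕ.^ (r ℕ.+ r)               ℕR.≤⟨ ℕ.*-monoˡ-≤ (t ℕ.^ (r ℕ.+ r)) 2N≤t² ⟩
    t ℕ.* t ℕ.* t ℕ.^ (r ℕ.+ r)               ℕR.≡⟨ cong (t ℕ.* t ℕ.*_) (ℕ.^-distribˡ-+-* t r r) ⟩
    t ℕ.* t ℕ.* (t ℕ.^ r ℕ.* t ℕ.^ r)         ℕR.≡⟨ regroup t (t ℕ.^ r) ⟩
    (t ℕ.^ r ℕ.* t) ℕ.* (t ℕ.^ r ℕ.* t)       ℕR.<⟨ ℕ.*-mono-< power power ⟩
    N ℕ.^ r ℕ.* N ℕ.^ r                       ℕR.≡⟨ ℕ.^-distribˡ-+-* N r r ⟨
    N ℕ.^ (r ℕ.+ r)                           ℕR.∎)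
  where
    module ℕR = ℕ.≤-Reasoning
    N = t ℕ.+ (r ℕ.+ r)
    regroup : ∀ t p → t ℕ.* t ℕ.* (p ℕ.* p) ≡ p ℕ.* t ℕ.* (p ℕ.* t)
    regroup = ℕ-Ring.solve-∀
    2N≤t² : 2 ℕ.* N ℕ.≤ t ℕ.* t
    2N≤t² = ℕ.≤-trans (ℕ.*-monoʳ-≤ 2 (ℕ.+-monoʳ-≤ t 2r≤t))
              (ℕ.≤-trans (ℕ.≤-reflexive (four t)) (ℕ.*-monoˡ-≤ t 4≤t))
      where
        four : ∀ t → 2 ℕ.* (t ℕ.+ t) ≡ 4 ℕ.* t
        four = ℕ-Ring.solve-∀

-- This is where the case distinction at b² = t/25 is used: with r² ≤ 4tb² it gives 25r² ≤ 4t², that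
-- is r ≤ 2t/5.
halving-bound : ∀ r t → 25 ℕ.* (r ℕ.* r) ℕ.≤ 4 ℕ.* (t ℕ.* t) → r ℕ.+ r ℕ.≤ t
halving-bound r t h = ℕ.≮⇒≥ λ t<2r → ℕ.<⇒≱ (ℕR.begin-strict
    4 ℕ.* (t ℕ.* t)                        ℕR.<⟨ ℕ.*-monoʳ-< 4 (ℕ.*-mono-< t<2r t<2r) ⟩
    4 ℕ.* ((r ℕ.+ r) ℕ.* (r ℕ.+ r))        ℕR.≡⟨ sixteen r ⟩
    16 ℕ.* (r ℕ.* r)                       ℕR.≤⟨ ℕ.*-monoˡ-≤ (r ℕ.* r) (ℕ.m≤m+n 16 9) ⟩
    25 ℕ.* (r ℕ.* r)                       ℕR.∎) h
  where
    module ℕR = ℕ.≤-Reasoning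
    sixteen : ∀ r → 4 ℕ.* ((r ℕ.+ r) ℕ.* (r ℕ.+ r)) ≡ 16 ℕ.* (r ℕ.* r)
    sixteen = ℕ-Ring.solve-∀

-- Write r for `suc r` and spread β over r steps of size h = β/r. From N ≤ 2t and tβ ≤ r² follows hN
-- ≤ 2r, hence t/N = 1 - 2r/N ≤ 1 - h. Then `exp-power-bound` gives (t/N)^r · e^β ≤ 1, where e^β
-- exceeds t.
power-from-exp : ∀ t r β → 1 ℕ.≤ t → 0ℚ ≤ β → suc r ℕ.+ suc r ℕ.≤ t → ℕ→ℚ t * β ≤ ℕ→ℚ (suc r ℕ.* suc r) →
  LtExp t β → t ℕ.^ suc r ℕ.* t ℕ.< (t ℕ.+ (suc r ℕ.+ suc r)) ℕ.^ suc r
power-from-exp t r β 1≤t 0≤β 2r≤t τβ≤r² (K , t<E) = ℕ→ℚ-cancel-< {t ℕ.^ suc r ℕ.* t} {N ℕ.^ suc r} (begin-strict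
  ℕ→ℚ (t ℕ.^ suc r ℕ.* t)                    ≡⟨ ℕ→ℚ-* (t ℕ.^ suc r) t ⟩
  ℕ→ℚ (t ℕ.^ suc r) * ℕ→ℚ t                  <⟨ *-monoʳ-<-pos (ℕ→ℚ (t ℕ.^ suc r)) {{positive (ℕ→ℚ-mono-< {0} {t ℕ.^ suc r} tʳ>0)}} t<E ⟩
  ℕ→ℚ (t ℕ.^ suc r) * expPartial β K         ≡⟨ cong (λ x → ℕ→ℚ (t ℕ.^ suc r) * expPartial x K) ρh≡β ⟨
  ℕ→ℚ (t ℕ.^ suc r) * expPartial (ρ * h) K   ≤⟨ exp-power-bound 0≤h t N rate K (suc r) ⟩
  ℕ→ℚ (N ℕ.^ suc r)                          ∎)
  where
    N = t ℕ.+ (suc r ℕ.+ suc r)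
    ρ = ℕ→ℚ (suc r)
    h = β * ((ℤ.+ 1) / suc r)
    0≤h : 0ℚ ≤ h
    0≤h = 0≤* 0≤β (0≤1/ r)
    ρh≡β : ρ * h ≡ β
    ρh≡β = trans (solve 3 (λ ρ β q → ρ :* (β :* q) := ρ :* q :* β) refl ρ β ((ℤ.+ 1) / suc r))
                 (trans (cong (_* β) (reciprocal r)) (*-identityˡ β))
    tʳ>0 : 0 ℕ.< t ℕ.^ suc r
    tʳ>0 = ℕ.m^n>0 t {{ℕ.>-nonZero 1≤t}} (suc r)
    hN≤2r : h * ℕ→ℚ N ≤ ℕ→ℚ (suc r ℕ.+ suc r)
    hN≤2r = *-cancelˡ-≤-pos ρ {{positive (ℕ→ℚ-mono-< {0} {suc r} (s≤s z≤n))}} (begin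
      ρ * (h * ℕ→ℚ N)                       ≡⟨ trans (sym (*-assoc ρ h (ℕ→ℚ N))) (cong (_* ℕ→ℚ N) ρh≡β) ⟩
      β * ℕ→ℚ N                             ≤⟨ *-monoʳ β 0≤β (ℕ→ℚ-mono-≤ {N} {t ℕ.+ t} (ℕ.+-monoʳ-≤ t 2r≤t)) ⟩
      β * ℕ→ℚ (t ℕ.+ t)                     ≡⟨ cong (β *_) (ℕ→ℚ-+ t t) ⟩
      β * (ℕ→ℚ t + ℕ→ℚ t)                   ≡⟨ solve 2 (λ β τ → β :* (τ :+ τ) := τ :* β :+ τ :* β) refl β (ℕ→ℚ t) ⟩
      ℕ→ℚ t * β + ℕ→ℚ t * β                 ≤⟨ +-mono-≤ τβ≤r² τβ≤r² ⟩
      ℕ→ℚ (suc r ℕ.* suc r) + ℕ→ℚ (suc r ℕ.* suc r)  ≡⟨ cong₂ _+_ (ℕ→ℚ-* (suc r) (suc r)) (ℕ→ℚ-* (suc r) (suc r)) ⟩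
      ρ * ρ + ρ * ρ                         ≡⟨ *-distribˡ-+ ρ ρ ρ ⟨
      ρ * (ρ + ρ)                           ≡⟨ cong (ρ *_) (ℕ→ℚ-+ (suc r) (suc r)) ⟨
      ρ * ℕ→ℚ (suc r ℕ.+ suc r)             ∎)
    rate : ℕ→ℚ t + h * ℕ→ℚ N ≤ ℕ→ℚ N
    rate = ≤-trans (+-monoʳ-≤ (ℕ→ℚ t) hN≤2r) (≤-reflexive (sym (ℕ→ℚ-+ t (suc r ℕ.+ suc r))))

-- Here (t + 2r)³ = t³ + 6t²r + 12tr² + 8r³, and 2r ≤ t turns the last term into at most 4tr². The
-- first-order term is controlled by tr ≤ 2ab, whose square is t²r² ≤ 4t³b² ≤ 4a²b²; the
-- second-order terms by r² ≤ 4tb². This uses 12 of the budget 30 and 64 of the budget 225.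
heavy-cost-small-b : ∀ t r a b → 0ℚ ≤ a → 0ℚ ≤ b → ℕ→ℚ (t ℕ.* t ℕ.* t) ≤ a * a → r ℕ.+ r ℕ.≤ t →
  ℕ→ℚ (r ℕ.* r) ≤ ℕ→ℚ 4 * (ℕ→ℚ t * (b * b)) → let N = t ℕ.+ (r ℕ.+ r) in
  ℕ→ℚ (N ℕ.* N ℕ.* N) ≤ (a + ℕ→ℚ 15 * ℕ→ℚ t * b) * (a + ℕ→ℚ 15 * ℕ→ℚ t * b)
heavy-cost-small-b t r a b 0≤a 0≤b t³≤a² 2r≤t r²≤ = begin
  ℕ→ℚ (N ℕ.* N ℕ.* N)                                             ≤⟨ ℕ→ℚ-mono-≤ {N ℕ.* N ℕ.* N} {t³ ℕ.+ (X ℕ.+ Y)} N³≤ ⟩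
  ℕ→ℚ (t³ ℕ.+ (X ℕ.+ Y))                                          ≡⟨ trans (ℕ→ℚ-+ t³ (X ℕ.+ Y)) (cong (ℕ→ℚ t³ +_) (ℕ→ℚ-+ X Y)) ⟩
  ℕ→ℚ t³ + (ℕ→ℚ X + ℕ→ℚ Y)                                        ≤⟨ heavy-budget t 0≤a 0≤b X≤ Y≤ t³≤a² ⟩
  (a + ℕ→ℚ 15 * τ * b) * (a + ℕ→ℚ 15 * τ * b)                     ∎
  where
    module ℕR = ℕ.≤-Reasoning
    τ = ℕ→ℚ t
    N = t ℕ.+ (r ℕ.+ r)
    t³ = t ℕ.* t ℕ.* t
    X = 6 ℕ.* (t ℕ.* (t ℕ.* r))
    Y = 16 ℕ.* (t ℕ.* (r ℕ.* r))
    N³≤ : N ℕ.* N ℕ.* N ℕ.≤ t³ ℕ.+ (X ℕ.+ Y)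
    N³≤ = ℕR.begin
      N ℕ.* N ℕ.* N                                                               ℕR.≡⟨ expand t r ⟩
      t³ ℕ.+ (X ℕ.+ 12 ℕ.* (t ℕ.* (r ℕ.* r))) ℕ.+ 4 ℕ.* ((r ℕ.+ r) ℕ.* (r ℕ.* r)) ℕR.≤⟨ ℕ.+-monoʳ-≤ (t³ ℕ.+ (X ℕ.+ 12 ℕ.* (t ℕ.* (r ℕ.* r)))) (ℕ.*-monoʳ-≤ 4 (ℕ.*-monoˡ-≤ (r ℕ.* r) 2r≤t)) ⟩
      t³ ℕ.+ (X ℕ.+ 12 ℕ.* (t ℕ.* (r ℕ.* r))) ℕ.+ 4 ℕ.* (t ℕ.* (r ℕ.* r))         ℕR.≡⟨ collect t³ X (t ℕ.* (r ℕ.* r)) ⟩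
      t³ ℕ.+ (X ℕ.+ Y)                                                            ℕR.∎
      where
        expand : ∀ t r → let N = t ℕ.+ (r ℕ.+ r) in N ℕ.* N ℕ.* N ≡
          t ℕ.* t ℕ.* t ℕ.+ (6 ℕ.* (t ℕ.* (t ℕ.* r)) ℕ.+ 12 ℕ.* (t ℕ.* (r ℕ.* r))) ℕ.+ 4 ℕ.* ((r ℕ.+ r) ℕ.* (r ℕ.* r))
        expand = ℕ-Ring.solve-∀
        collect : ∀ c x y → c ℕ.+ (x ℕ.+ 12 ℕ.* y) ℕ.+ 4 ℕ.* y ≡ c ℕ.+ (x ℕ.+ 16 ℕ.* y)
        collect = ℕ-Ring.solve-∀
    tr≤2ab : ℕ→ℚ (t ℕ.* r) ≤ ℕ→ℚ 2 * (a * b)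
    tr≤2ab = square-cancel-≤ (0≤* (0≤ℕ→ℚ 2) (0≤* 0≤a 0≤b)) (begin
      ℕ→ℚ (t ℕ.* r) * ℕ→ℚ (t ℕ.* r)                ≡⟨ cong₂ _*_ (ℕ→ℚ-* t r) (ℕ→ℚ-* t r) ⟩
      τ * ℕ→ℚ r * (τ * ℕ→ℚ r)                      ≡⟨ solve 2 (λ τ ρ → τ :* ρ :* (τ :* ρ) := τ :* τ :* (ρ :* ρ)) refl τ (ℕ→ℚ r) ⟩
      τ * τ * (ℕ→ℚ r * ℕ→ℚ r)                      ≡⟨ cong (τ * τ *_) (ℕ→ℚ-* r r) ⟨
      τ * τ * ℕ→ℚ (r ℕ.* r)                        ≤⟨ *-monoʳ (τ * τ) (0≤* (0≤ℕ→ℚ t) (0≤ℕ→ℚ t)) r²≤ ⟩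
      τ * τ * (ℕ→ℚ 4 * (τ * (b * b)))              ≡⟨ solve 2 (λ τ β → τ :* τ :* (con (ℕ→ℚ 4) :* (τ :* β)) := τ :* τ :* τ :* (con (ℕ→ℚ 4) :* β)) refl τ (b * b) ⟩
      τ * τ * τ * (ℕ→ℚ 4 * (b * b))                ≡⟨ cong (_* (ℕ→ℚ 4 * (b * b))) (ℕ→ℚ-cube t) ⟨
      ℕ→ℚ t³ * (ℕ→ℚ 4 * (b * b))                   ≤⟨ *-monoˡ (ℕ→ℚ 4 * (b * b)) (0≤* (0≤ℕ→ℚ 4) (0≤* 0≤b 0≤b)) t³≤a² ⟩
      a * a * (ℕ→ℚ 4 * (b * b))                    ≡⟨ solve 2 (λ a b → a :* a :* (con (ℕ→ℚ 4) :* (b :* b)) := con (ℕ→ℚ 2) :* (a :* b) :* (con (ℕ→ℚ 2) :* (a :* b))) refl a b ⟩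
      ℕ→ℚ 2 * (a * b) * (ℕ→ℚ 2 * (a * b))          ∎)
    X≤ : ℕ→ℚ X ≤ ℕ→ℚ 30 * (a * (τ * b))
    X≤ = begin
      ℕ→ℚ X                                        ≡⟨ trans (ℕ→ℚ-* 6 (t ℕ.* (t ℕ.* r))) (cong (ℕ→ℚ 6 *_) (ℕ→ℚ-* t (t ℕ.* r))) ⟩
      ℕ→ℚ 6 * (τ * ℕ→ℚ (t ℕ.* r))                  ≤⟨ *-monoʳ (ℕ→ℚ 6) (0≤ℕ→ℚ 6) (*-monoʳ τ (0≤ℕ→ℚ t) tr≤2ab) ⟩
      ℕ→ℚ 6 * (τ * (ℕ→ℚ 2 * (a * b)))              ≡⟨ solve 3 (λ τ a b → con (ℕ→ℚ 6) :* (τ :* (con (ℕ→ℚ 2) :* (a :* b))) := con (ℕ→ℚ 12) :* (a :* (τ :* b))) refl τ a b ⟩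
      ℕ→ℚ 12 * (a * (τ * b))                       ≤⟨ *-monoˡ (a * (τ * b)) (0≤* 0≤a (0≤* (0≤ℕ→ℚ t) 0≤b)) (ℕ→ℚ-mono-≤ {12} {30} (ℕ.m≤m+n 12 18)) ⟩
      ℕ→ℚ 30 * (a * (τ * b))                       ∎
    Y≤ : ℕ→ℚ Y ≤ ℕ→ℚ 225 * (τ * τ * (b * b))
    Y≤ = begin
      ℕ→ℚ Y                                        ≡⟨ trans (ℕ→ℚ-* 16 (t ℕ.* (r ℕ.* r))) (cong (ℕ→ℚ 16 *_) (ℕ→ℚ-* t (r ℕ.* r))) ⟩
      ℕ→ℚ 16 * (τ * ℕ→ℚ (r ℕ.* r))                 ≤⟨ *-monoʳ (ℕ→ℚ 16) (0≤ℕ→ℚ 16) (*-monoʳ τ (0≤ℕ→ℚ t) r²≤) ⟩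
      ℕ→ℚ 16 * (τ * (ℕ→ℚ 4 * (τ * (b * b))))       ≡⟨ solve 2 (λ τ β → con (ℕ→ℚ 16) :* (τ :* (con (ℕ→ℚ 4) :* (τ :* β))) := con (ℕ→ℚ 64) :* (τ :* τ :* β)) refl τ (b * b) ⟩
      ℕ→ℚ 64 * (τ * τ * (b * b))                   ≤⟨ *-monoˡ (τ * τ * (b * b)) (0≤* (0≤* (0≤ℕ→ℚ t) (0≤ℕ→ℚ t)) (0≤* 0≤b 0≤b)) (ℕ→ℚ-mono-≤ {64} {225} (ℕ.m≤m+n 64 161)) ⟩
      ℕ→ℚ 225 * (τ * τ * (b * b))                  ∎

-- Rounding up at most doubles a root that is at least 1, since r + 2 ≤ 2(r + 1). For a smaller root
-- the rounded value is 1, which is the case covered by 1 ≤ 4q.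
⌈√⌉²≤4q : ∀ r {q} → 1ℚ ≤ ℕ→ℚ 4 * q → ℕ→ℚ (r ℕ.* r) ≤ q → ℕ→ℚ (suc r ℕ.* suc r) ≤ ℕ→ℚ 4 * q
⌈√⌉²≤4q zero    1≤4q _ = 1≤4q
⌈√⌉²≤4q (suc r) {q} _ r²≤q = begin
  ℕ→ℚ ((2 ℕ.+ r) ℕ.* (2 ℕ.+ r))            ≤⟨ ℕ→ℚ-mono-≤ {(2 ℕ.+ r) ℕ.* (2 ℕ.+ r)} {4 ℕ.* (suc r ℕ.* suc r)}
                                                (ℕ.≤-trans (ℕ.m≤m+n _ (4 ℕ.* r ℕ.+ 3 ℕ.* (r ℕ.* r))) (ℕ.≤-reflexive (identity r))) ⟩
  ℕ→ℚ (4 ℕ.* (suc r ℕ.* suc r))            ≡⟨ ℕ→ℚ-* 4 (suc r ℕ.* suc r) ⟩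
  ℕ→ℚ 4 * ℕ→ℚ (suc r ℕ.* suc r)            ≤⟨ *-monoʳ (ℕ→ℚ 4) (0≤ℕ→ℚ 4) r²≤q ⟩
  ℕ→ℚ 4 * q                                ∎
  where
    identity : ∀ r → (2 ℕ.+ r) ℕ.* (2 ℕ.+ r) ℕ.+ (4 ℕ.* r ℕ.+ 3 ℕ.* (r ℕ.* r)) ≡ 4 ℕ.* ((1 ℕ.+ r) ℕ.* (1 ℕ.+ r))
    identity = ℕ-Ring.solve-∀

parameters-small-b : ∀ t → 14 ℕ.≤ t → ∀ a b → 0ℚ ≤ a → 0ℚ < b → ℕ→ℚ (t ℕ.* t ℕ.* t) ≤ a * a →
                     LtExp t (b * b) → ℕ→ℚ 25 * (b * b) ≤ ℕ→ℚ t → Parameters t a b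
parameters-small-b t 14≤t a b 0≤a 0<b t³≤a² t<exp 25β≤τ =
  -- The search may start at t because b² ≤ t makes tb² at most t².
  build (⌈√⌉ (*-positive 0<τ 0<β) t (≤-trans (*-monoʳ τ (0≤ℕ→ℚ t) β≤τ) (≤-reflexive (sym (ℕ→ℚ-* t t)))))
  where
    τ = ℕ→ℚ t
    β = b * b
    *-positive : ∀ {x y} → 0ℚ < x → 0ℚ < y → 0ℚ < x * y
    *-positive {x} {y} 0<x 0<y = subst (_< x * y) (*-zeroʳ x) (*-monoʳ-<-pos x {{positive 0<x}} 0<y)
    0<τ : 0ℚ < τ
    0<τ = ℕ→ℚ-mono-< {0} {t} (ℕ.≤-trans (s≤s z≤n) 14≤t)
    0<β : 0ℚ < β
    0<β = *-positive 0<b 0<b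
    0≤β : 0ℚ ≤ β
    0≤β = <⇒≤ 0<β
    β≤τ : β ≤ τ
    β≤τ = ≤-trans (subst (_≤ ℕ→ℚ 25 * β) (*-identityˡ β) (*-monoˡ β 0≤β (ℕ→ℚ-mono-≤ {1} {25} (s≤s z≤n)))) 25β≤τ
    1≤4τβ : 1ℚ ≤ ℕ→ℚ 4 * (τ * β)
    1≤4τβ = begin
      1ℚ                     ≤⟨ <⇒≤ (LtExp⇒1<2x {t} (ℕ.≤-trans (s≤s (s≤s z≤n)) 14≤t) 0≤β t<exp) ⟩
      β + β                  ≡⟨ solve 1 (λ β → β :+ β := con (ℕ→ℚ 2) :* (con 1ℚ :* β)) refl β ⟩
      ℕ→ℚ 2 * (1ℚ * β)       ≤⟨ *-mono-≤-nonNeg (0≤* (0≤ℕ→ℚ 1) 0≤β) (0≤ℕ→ℚ 4) (ℕ→ℚ-mono-≤ {2} {4} (ℕ.m≤m+n 2 2))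
                                  (*-monoˡ β 0≤β (ℕ→ℚ-mono-≤ {1} {t} (ℕ.≤-trans (s≤s z≤n) 14≤t))) ⟩
      ℕ→ℚ 4 * (τ * β)        ∎
    build : (Σ ℕ λ r → ℕ→ℚ (r ℕ.* r) < τ * β × τ * β ≤ ℕ→ℚ (suc r ℕ.* suc r)) → Parameters t a b
    build (r′ , r′²< , ≤r²) = record
      -- Here r is b√t rounded up. Taking s and k both equal to 2r makes t + s - k equal to t, so
      -- the hitting-set condition is about (t/N)^(2r), the square of what the exponential controls.
      { s = r ℕ.+ r ; k = r ℕ.+ r
      ; numeric = numeric-from-power t r (ℕ.≤-trans (ℕ.m≤m+n 4 10) 14≤t) 2r≤t
          (power-from-exp t r′ β (ℕ.≤-trans (s≤s z≤n) 14≤t) 0≤β 2r≤t ≤r² t<exp)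
      ; light-cost = begin
          ℕ→ℚ (45 ℕ.* ((r ℕ.+ r) ℕ.* (r ℕ.+ r)))  ≤⟨ ℕ→ℚ-mono-≤ {45 ℕ.* ((r ℕ.+ r) ℕ.* (r ℕ.+ r))} {400 ℕ.* (r ℕ.* r)}
                                                       (ℕ.≤-trans (ℕ.≤-reflexive (identity r)) (ℕ.*-monoˡ-≤ (r ℕ.* r) (ℕ.m≤m+n 180 220))) ⟩
          ℕ→ℚ (400 ℕ.* (r ℕ.* r))                 ≡⟨ ℕ→ℚ-* 400 (r ℕ.* r) ⟩
          ℕ→ℚ 400 * ℕ→ℚ (r ℕ.* r)                 ≤⟨ *-monoʳ (ℕ→ℚ 400) (0≤ℕ→ℚ 400) r²≤ ⟩
          ℕ→ℚ 400 * (ℕ→ℚ 4 * (τ * β))             ≡⟨ *-assoc (ℕ→ℚ 400) (ℕ→ℚ 4) (τ * β) ⟨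
          ℕ→ℚ 1600 * (τ * β)                      ∎
      ; heavy-cost = heavy-cost-small-b t r a b 0≤a (<⇒≤ 0<b) t³≤a² 2r≤t r²≤
      }
      where
        r = suc r′
        identity : ∀ r → 45 ℕ.* ((r ℕ.+ r) ℕ.* (r ℕ.+ r)) ≡ 180 ℕ.* (r ℕ.* r)
        identity = ℕ-Ring.solve-∀
        r²≤ : ℕ→ℚ (r ℕ.* r) ≤ ℕ→ℚ 4 * (τ * β)
        r²≤ = ⌈√⌉²≤4q r′ 1≤4τβ (<⇒≤ r′²<)
        2r≤t : r ℕ.+ r ℕ.≤ t
        2r≤t = halving-bound r t (ℕ→ℚ-cancel-≤ {25 ℕ.* (r ℕ.* r)} {4 ℕ.* (t ℕ.* t)} (begin
          ℕ→ℚ (25 ℕ.* (r ℕ.* r))                  ≡⟨ ℕ→ℚ-* 25 (r ℕ.* r) ⟩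
          ℕ→ℚ 25 * ℕ→ℚ (r ℕ.* r)                  ≤⟨ *-monoʳ (ℕ→ℚ 25) (0≤ℕ→ℚ 25) r²≤ ⟩
          ℕ→ℚ 25 * (ℕ→ℚ 4 * (τ * β))              ≡⟨ solve 2 (λ τ β → con (ℕ→ℚ 25) :* (con (ℕ→ℚ 4) :* (τ :* β)) := con (ℕ→ℚ 4) :* (τ :* (con (ℕ→ℚ 25) :* β))) refl τ β ⟩
          ℕ→ℚ 4 * (τ * (ℕ→ℚ 25 * β))              ≤⟨ *-monoʳ (ℕ→ℚ 4) (0≤ℕ→ℚ 4) (*-monoʳ τ (0≤ℕ→ℚ t) 25β≤τ) ⟩
          ℕ→ℚ 4 * (τ * τ)                         ≡⟨ trans (ℕ→ℚ-* 4 (t ℕ.* t)) (cong (ℕ→ℚ 4 *_) (ℕ→ℚ-* t t)) ⟨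
          ℕ→ℚ (4 ℕ.* (t ℕ.* t))                   ∎))

parameters : ∀ t → 14 ℕ.≤ t → ∀ a b → 0ℚ < a → 0ℚ < b → ℕ→ℚ t * ℕ→ℚ t * ℕ→ℚ t < a * a →
             LtExp t (b * b) → Parameters t a b
parameters t 14≤t a b 0<a 0<b τ³<a² t<exp = by-size (≤-total (ℕ→ℚ t) (ℕ→ℚ 25 * (b * b)))
  where
    t³≤a² : ℕ→ℚ (t ℕ.* t ℕ.* t) ≤ a * a
    t³≤a² = subst (_≤ a * a) (sym (ℕ→ℚ-cube t)) (<⇒≤ τ³<a²)
    by-size : ℕ→ℚ t ≤ ℕ→ℚ 25 * (b * b) ⊎ ℕ→ℚ 25 * (b * b) ≤ ℕ→ℚ t → Parameters t a b
    by-size (inj₁ large) = parameters-large-b t 14≤t a b (<⇒≤ 0<a) (<⇒≤ 0<b) t³≤a² large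
    by-size (inj₂ small) = parameters-small-b t 14≤t a b (<⇒≤ 0<a) 0<b t³≤a² t<exp small

-- Adding the costs of light and heavy edges

combine : ∀ {t a b} (p : Parameters t a b) → 0ℚ ≤ a → 0ℚ ≤ b → let open Parameters p in
  ∀ n m links heavies → 6 ℕ.* m ℕ.≤ 3 ℕ.* k ℕ.* links ℕ.+ (t ℕ.+ s) ℕ.* heavies →
  links ℕ.* links ℕ.≤ 5 ℕ.* t ℕ.* (n ℕ.* n ℕ.* n) →
  heavies ℕ.* heavies ℕ.≤ (t ℕ.+ s) ℕ.* (n ℕ.* n ℕ.* n) →
  ℕ→ℚ 36 * (ℕ→ℚ m * ℕ→ℚ m)
    ≤ ((a + ℕ→ℚ 55 * ℕ→ℚ t * b) * (a + ℕ→ℚ 55 * ℕ→ℚ t * b)) * (ℕ→ℚ n * ℕ→ℚ n * ℕ→ℚ n)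
combine {t} {a} {b} p 0≤a 0≤b n m links heavies 6m≤ links² heavies² = begin
  ℕ→ℚ 36 * (ℕ→ℚ m * ℕ→ℚ m)                   ≡⟨ solve 1 (λ m → con (ℕ→ℚ 36) :* (m :* m) := con (ℕ→ℚ 6) :* m :* (con (ℕ→ℚ 6) :* m)) refl (ℕ→ℚ m) ⟩
  ℕ→ℚ 6 * ℕ→ℚ m * (ℕ→ℚ 6 * ℕ→ℚ m)            ≤⟨ *-mono-≤-nonNeg (0≤* (0≤ℕ→ℚ 6) (0≤ℕ→ℚ m)) (0≤+ (0≤ℕ→ℚ X) (0≤ℕ→ℚ Y)) 6m≤X+Y 6m≤X+Y ⟩
  -- In terms of roots, X ≤ 40tb · n^{3/2} and Y ≤ (a + 15tb) · n^{3/2}. With z = n³ the two bounds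
  -- add up without naming √(n³).
  (ℕ→ℚ X + ℕ→ℚ Y) * (ℕ→ℚ X + ℕ→ℚ Y)          ≤⟨ square-+-≤ {ℕ→ℚ X} {ℕ→ℚ Y} {L} {M} {ν³} (0≤ℕ→ℚ X) (0≤ℕ→ℚ Y) 0≤L 0≤M 0≤ν³ X² Y² ⟩
  (L + M) * (L + M) * ν³                     ≡⟨ cong (λ w → w * w * ν³) (solve 3 (λ a τ b → con (ℕ→ℚ 40) :* τ :* b :+ (a :+ con (ℕ→ℚ 15) :* τ :* b) := a :+ con (ℕ→ℚ 55) :* τ :* b) refl a τ b) ⟩
  (a + ℕ→ℚ 55 * τ * b) * (a + ℕ→ℚ 55 * τ * b) * ν³ ∎
  where
    open Parameters p
    module ℕR = ℕ.≤-Reasoning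
    τ = ℕ→ℚ t
    ν³ = ℕ→ℚ n * ℕ→ℚ n * ℕ→ℚ n
    n³ = n ℕ.* n ℕ.* n
    N = t ℕ.+ s
    X = 3 ℕ.* k ℕ.* links
    Y = N ℕ.* heavies
    L = ℕ→ℚ 40 * τ * b
    M = a + ℕ→ℚ 15 * τ * b
    0≤ν³ : 0ℚ ≤ ν³
    0≤ν³ = 0≤* (0≤* (0≤ℕ→ℚ n) (0≤ℕ→ℚ n)) (0≤ℕ→ℚ n)
    0≤L : 0ℚ ≤ L
    0≤L = 0≤* (0≤* (0≤ℕ→ℚ 40) (0≤ℕ→ℚ t)) 0≤b
    0≤M : 0ℚ ≤ M
    0≤M = 0≤+ 0≤a (0≤* (0≤* (0≤ℕ→ℚ 15) (0≤ℕ→ℚ t)) 0≤b)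
    6m≤X+Y : ℕ→ℚ 6 * ℕ→ℚ m ≤ ℕ→ℚ X + ℕ→ℚ Y
    6m≤X+Y = begin
      ℕ→ℚ 6 * ℕ→ℚ m      ≡⟨ ℕ→ℚ-* 6 m ⟨
      ℕ→ℚ (6 ℕ.* m)      ≤⟨ ℕ→ℚ-mono-≤ {6 ℕ.* m} {X ℕ.+ Y} 6m≤ ⟩
      ℕ→ℚ (X ℕ.+ Y)      ≡⟨ ℕ→ℚ-+ X Y ⟩
      ℕ→ℚ X + ℕ→ℚ Y      ∎
    X²≤ : X ℕ.* X ℕ.≤ t ℕ.* (45 ℕ.* (k ℕ.* k)) ℕ.* n³
    X²≤ = ℕR.begin
      X ℕ.* X                                          ℕR.≡⟨ square k links ⟩
      9 ℕ.* (k ℕ.* k) ℕ.* (links ℕ.* links)            ℕR.≤⟨ ℕ.*-monoʳ-≤ (9 ℕ.* (k ℕ.* k)) links² ⟩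
      9 ℕ.* (k ℕ.* k) ℕ.* (5 ℕ.* t ℕ.* n³)             ℕR.≡⟨ regroup k t n³ ⟩
      t ℕ.* (45 ℕ.* (k ℕ.* k)) ℕ.* n³                  ℕR.∎
      where
        square : ∀ k l → 3 ℕ.* k ℕ.* l ℕ.* (3 ℕ.* k ℕ.* l) ≡ 9 ℕ.* (k ℕ.* k) ℕ.* (l ℕ.* l)
        square = ℕ-Ring.solve-∀
        regroup : ∀ k t z → 9 ℕ.* (k ℕ.* k) ℕ.* (5 ℕ.* t ℕ.* z) ≡ t ℕ.* (45 ℕ.* (k ℕ.* k)) ℕ.* z
        regroup = ℕ-Ring.solve-∀
    X² : ℕ→ℚ X * ℕ→ℚ X ≤ L * L * ν³
    X² = begin
      ℕ→ℚ X * ℕ→ℚ X                                 ≡⟨ ℕ→ℚ-* X X ⟨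
      ℕ→ℚ (X ℕ.* X)                                 ≤⟨ ℕ→ℚ-mono-≤ {X ℕ.* X} {t ℕ.* (45 ℕ.* (k ℕ.* k)) ℕ.* n³} X²≤ ⟩
      ℕ→ℚ (t ℕ.* (45 ℕ.* (k ℕ.* k)) ℕ.* n³)         ≡⟨ trans (ℕ→ℚ-* (t ℕ.* (45 ℕ.* (k ℕ.* k))) n³) (cong₂ _*_ (ℕ→ℚ-* t (45 ℕ.* (k ℕ.* k))) (ℕ→ℚ-cube n)) ⟩
      τ * ℕ→ℚ (45 ℕ.* (k ℕ.* k)) * ν³               ≤⟨ *-monoˡ ν³ 0≤ν³ (*-monoʳ τ (0≤ℕ→ℚ t) light-cost) ⟩
      τ * (ℕ→ℚ 1600 * (τ * (b * b))) * ν³           ≡⟨ cong (_* ν³) (solve 2 (λ τ b → τ :* (con (ℕ→ℚ 1600) :* (τ :* (b :* b))) := con (ℕ→ℚ 40) :* τ :* b :* (con (ℕ→ℚ 40) :* τ :* b)) refl τ b) ⟩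
      L * L * ν³                                    ∎
    Y²≤ : Y ℕ.* Y ℕ.≤ N ℕ.* N ℕ.* N ℕ.* n³
    Y²≤ = ℕR.begin
      Y ℕ.* Y                                ℕR.≡⟨ square N heavies ⟩
      N ℕ.* N ℕ.* (heavies ℕ.* heavies)      ℕR.≤⟨ ℕ.*-monoʳ-≤ (N ℕ.* N) heavies² ⟩
      N ℕ.* N ℕ.* (N ℕ.* n³)                 ℕR.≡⟨ ℕ.*-assoc (N ℕ.* N) N n³ ⟨
      N ℕ.* N ℕ.* N ℕ.* n³                   ℕR.∎
      where
        square : ∀ N h → N ℕ.* h ℕ.* (N ℕ.* h) ≡ N ℕ.* N ℕ.* (h ℕ.* h)
        square = ℕ-Ring.solve-∀
    Y² : ℕ→ℚ Y * ℕ→ℚ Y ≤ M * M * ν³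
    Y² = begin
      ℕ→ℚ Y * ℕ→ℚ Y                    ≡⟨ ℕ→ℚ-* Y Y ⟨
      ℕ→ℚ (Y ℕ.* Y)                    ≤⟨ ℕ→ℚ-mono-≤ {Y ℕ.* Y} {N ℕ.* N ℕ.* N ℕ.* n³} Y²≤ ⟩
      ℕ→ℚ (N ℕ.* N ℕ.* N ℕ.* n³)       ≡⟨ trans (ℕ→ℚ-* (N ℕ.* N ℕ.* N) n³) (cong (ℕ→ℚ (N ℕ.* N ℕ.* N) *_) (ℕ→ℚ-cube n)) ⟩
      ℕ→ℚ (N ℕ.* N ℕ.* N) * ν³         ≤⟨ *-monoˡ ν³ 0≤ν³ heavy-cost ⟩
      M * M * ν³                       ∎

theorem2p1 : (t : ℕ) → 14 ≤ℕ t →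
    (a b : ℚ) → 0ℚ < a → ℕ→ℚ t * ℕ→ℚ t * ℕ→ℚ t < a * a →
    0ℚ < b → LtExp t (b * b) →
    Σ ℕ λ N → (n : ℕ) → N ≤ℕ n → (H : Hypergraph3 n) → ¬ ContainsK2tTrace t H →
    ℕ→ℚ 36 * (ℕ→ℚ (numEdges H) * ℕ→ℚ (numEdges H))
    ≤ ((a + ℕ→ℚ 55 * ℕ→ℚ t * b) * (a + ℕ→ℚ 55 * ℕ→ℚ t * b))
    * (ℕ→ℚ n * ℕ→ℚ n * ℕ→ℚ n)
-- The threshold depends only on t, s and k, hence on t, a and b but not on the hypergraph.
theorem2p1 t 14≤t a b 0<a τ³<a² 0<b t<exp = n₀ , λ n n₀≤n H free → estimate n H (Counting.bounds H k t s (ℕ.≤-trans (ℕ.m≤m+n 2 12) 14≤t) numeric n₀≤n free)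
  where
    p : Parameters t a b
    p = parameters t 14≤t a b 0<a 0<b τ³<a² t<exp
    open Parameters p
    n₀ : ℕ
    n₀ = (5 ℕ.* t ℕ.+ (t ℕ.+ s)) ℕ.* ((3 ℕ.* k ℕ.+ (t ℕ.+ s) ℕ.+ 1) ℕ.* (3 ℕ.* k ℕ.+ (t ℕ.+ s) ℕ.+ 1))
    estimate : ∀ n (H : Hypergraph3 n) → Counting.Bounds H k t (t ℕ.+ s) →
      ℕ→ℚ 36 * (ℕ→ℚ (numEdges H) * ℕ→ℚ (numEdges H))
        ≤ ((a + ℕ→ℚ 55 * ℕ→ℚ t * b) * (a + ℕ→ℚ 55 * ℕ→ℚ t * b)) * (ℕ→ℚ n * ℕ→ℚ n * ℕ→ℚ n)
    estimate n H B = combine p (<⇒≤ 0<a) (<⇒≤ 0<b) n (numEdges H) links heavies 6*edges≤ links² heavies²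
      where open Counting.Bounds B
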